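{- There exists a polynomial $p$ such that for every $n\in\mathbb{N}$ and every $\varepsilon\in(0,1)$ there exists a (not necessarily explicit) deterministic nonadaptive $\varepsilon$-sampler, with query complexity at most $p(n/\varepsilon)$, for the class of functions $\{0,1\}^n\to\{0,1\}$ computed by permutation branching programs of length $n$ and arbitrary (unbounded) finite width with a single accept state.
   Context: An ordered branching program $B$ of length $n$ and width $w$ has layers $V_0,\dots,V_n$, each a copy of $\{1,\dots,w\}$, a start state $v_0\in V_0$, transition functions $B_r:V_{r-1}\times\{0,1\}\to V_r$ for $r=1,\dots,n$, and a set $V_{\mathit{acc}}\subseteq V_n$ of accept states. On input $\sigma\in\{0,1\}^n$ it sets $v_r=B_r(v_{r-1},\sigma_r)$ and $B(\sigma)=1$ iff $v_n\in V_{\mathit{acc}}$. It is a permutation branching program if for every $r$ and $b\in\{0,1\}$ the map $B_r(\cdot,b)$ is a permutation of $\{1,\dots,w\}$. "Unbounded width" means the width $w$ may be any natural number. For a class $\mathcal{F}$ of functions $\{0,1\}^n\to\{0,1\}$, a deterministic $\varepsilon$-sampler is a deterministic algorithm that, given oracle access to any $f\in\mathcal{F}$, makes queries to $f$ and outputs a real number $\mathrm{Samp}^f()$ with $|\mathrm{Samp}^f()-\Pr_{x\sim U_n}[f(x)=1]|\le\varepsilon$, where $U_n$ is uniform on $\{0,1\}^n$. Its query complexity is the maximum over $f\in\mathcal{F}$ of the number of distinct queries made. It is nonadaptive if its queries do not depend on the answers to previous queries. -}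

module Defs where

open import Data.Nat using (ℕ; zero; suc; _^_)
import Data.Nat as ℕ
open import Data.Nat.Properties using (m^n≢0)
open import Data.Integer using (+_)
open import Data.Bool using (Bool; true; false)
open import Data.Fin using (Fin; zero; suc)
open import Data.Fin.Permutation using (Permutation′; _⟨$⟩ʳ_)
open import Data.Vec using (Vec; []; _∷_)
open import Data.Vec.Properties using (≡-dec)
open import Data.Bool.Properties using () renaming (_≟_ to _≟B_)
open import Data.List using (List; []; _∷_; map; length; deduplicate; _++_; concatMap; filter)
open import Data.Rational using (ℚ; 0ℚ; _+_; _*_; _/_; _-_; ∣_∣; _≤_; _<_; 1ℚ)
open import Data.Product using (Σ; _×_; _,_)
open import Relation.Binary.PropositionalEquality using (_≡_)
open import Relation.Binary.Core using (Rel)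
open import Relation.Nullary.Decidable using (does)
open import Function using (_∘_)

BoolFun : ℕ → Set
BoolFun n = Vec Bool n → Bool

-- Ordered permutation branching program of length n and width w,
-- with a single accept state. Layer r+1 transition (r : Fin n) is
-- trans r b : a permutation of {1..w} (modelled as Fin w).
record PermBP (n w : ℕ) : Set where
  field
    start  : Fin w
    trans  : Fin n → Bool → Permutation′ w
    accept : Fin w

runFrom : ∀ {n w} → (Fin n → Bool → Permutation′ w) → Fin w → Vec Bool n → Fin w
runFrom t v [] = v
runFrom t v (b ∷ σ) = runFrom (t ∘ suc) (t zero b ⟨$⟩ʳ v) σ

eqFin : ∀ {w} → Fin w → Fin w → Bool
eqFin a b = does (a Data.Fin.≟ b)

evalBP : ∀ {n w} → PermBP n w → BoolFun n
evalBP B σ = eqFin (runFrom (PermBP.trans B) (PermBP.start B) σ) (PermBP.accept B)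

InPermBPClass : (n : ℕ) → BoolFun n → Set
InPermBPClass n f = Σ ℕ λ w → Σ (PermBP n w) λ B → ∀ σ → f σ ≡ evalBP B σ

allInputs : (n : ℕ) → List (Vec Bool n)
allInputs zero = [] ∷ []
allInputs (suc n) = map (false ∷_) (allInputs n) ++ map (true ∷_) (allInputs n)

countOnes : ∀ {n} → BoolFun n → ℕ
countOnes {n} f = length (filter (λ x → f x Data.Bool.≟ true) (allInputs n))

prob : ∀ {n} → BoolFun n → ℚ
prob {n} f = _/_ (+ countOnes f) (2 ^ n) {{m^n≢0 2 n}}

record NonadaptiveAlg (n : ℕ) : Set where
  field
    queries : List (Vec Bool n)
    output  : List Bool → ℚ

runAlg : ∀ {n} → NonadaptiveAlg n → BoolFun n → ℚ
runAlg A f = NonadaptiveAlg.output A (map f (NonadaptiveAlg.queries A))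

queryComplexity : ∀ {n} → NonadaptiveAlg n → ℕ
queryComplexity A = length (deduplicate (≡-dec _≟B_) (NonadaptiveAlg.queries A))

IsSampler : ∀ {n} → (BoolFun n → Set) → ℚ → NonadaptiveAlg n → Set
IsSampler {n} 𝓕 ε A = ∀ (f : BoolFun n) → 𝓕 f → ∣ runAlg A f - prob f ∣ ≤ ε

-- polynomials with rational coefficients (list, constant term first)
Poly : Set
Poly = List ℚ

evalPoly : Poly → ℚ → ℚ
evalPoly [] x = 0ℚ
evalPoly (c ∷ cs) x = c + x * evalPoly cs x

ℕtoℚ : ℕ → ℚ
ℕtoℚ k = (+ k) / 1

{-# OPTIONS --safe #-}

-- Cut a permutation program f at layer r. A prefix x leads to one state, a suffix y leads to acceptance from
-- exactly one state, and f (x y) = 1 iff the two states coincide. Let H k be a hitting set for the programs of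
-- length k with acceptance probability at least δ. The queries are H n and all x y and x b y′ with x ∈ H r,
-- y ∈ H (n - r), y′ ∈ H (n - r - 1) and b a bit. From the answers, a path of f is certified accepting by a chain
-- of suffixes y₀, y₁, …, each pinning down the state at its layer: x leads to the state of y when f (x y) = 1,
-- and reading b there leads to the state of y′ when f (x b y′) = 1. Certified inputs are accepted by f, and an
-- accepted input is certified unless its path meets a state that is reached, or accepts, with probability below
-- δ; at each layer this excludes probability at most 2 δ. The sampler outputs the probability of being certified.
--
-- Small hitting sets exist because a program accepting with probability δ contains a narrow one: dropping the
-- states that accept with probability below δ / 2 loses at most δ / 2 and leaves at most 2 / δ states per layer.
-- There are only exponentially many narrow programs, so a greedy choice of polynomially many points hits them all.

module Submission where

open import Defs
open import Algebra.Properties.Group using (⁻¹-anti-homo-//)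
open import Data.Bool using (Bool; true; false; _∧_; not; T; T?; if_then_else_)
open import Data.Bool.ListAction using (any)
open import Data.Bool.Properties using (T-∧) renaming (_≟_ to _≟B_)
open import Data.Fin using (Fin; zero; suc; finToFun; funToFin)
open import Data.Fin.Permutation using (Permutation′; _⟨$⟩ʳ_; flip; inverseˡ; inverseʳ)
open import Data.Fin.Properties using (finToFun-funToFin)
import Data.Integer as ℤ
import Data.Integer.Properties as ℤ
open import Data.List as List using (List; []; _∷_; _++_; length; allFin; filter; cartesianProduct; cartesianProductWith)
open import Data.List.Membership.Propositional using (_∈_; find; lose)
open import Data.List.Membership.Propositional.Properties
open import Data.List.Properties using (length-++; length-map; length-tabulate; length-filter; filter-++; length-deduplicate)
open import Data.List.Relation.Unary.All as All using (All; []; _∷_)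
open import Data.List.Relation.Unary.All.Properties as All using (all-filter)
open import Data.List.Relation.Unary.AllPairs using ([]; _∷_)
open import Data.List.Relation.Unary.Any using (Any; here; there)
open import Data.List.Relation.Unary.Any.Properties using (++⁺ˡ; ++⁺ʳ; any⁺; any⁻)
open import Data.List.Relation.Unary.Unique.Propositional using (Unique)
open import Data.List.Relation.Unary.Unique.Propositional.Properties as Unique using (allFin⁺)
open import Data.Maybe using (Maybe; just; nothing; maybe)
open import Data.Nat using (ℕ; zero; suc)
import Data.Nat as ℕ
import Data.Nat.Properties as ℕ
open import Data.Nat.Coprimality as Coprime using (Coprime)
import Data.Nat.DivMod as ℕ
open import Data.Nat.Tactic.RingSolver using (solve-∀)
open import Data.Product using (Σ; ∃; _×_; _,_; proj₁; proj₂)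
open import Data.Rational.Unnormalised as ℚᵘ using (mkℚᵘ)
import Data.Rational.Unnormalised.Properties as ℚᵘ
open import Data.Sum using (_⊎_; inj₁; inj₂)
open import Data.Unit using (tt)
open import Data.Vec using (Vec; []; _∷_; map; tabulate)
open import Data.Vec.Properties using (≡-dec)
open import Function using (_∘_)
open import Function.Bundles using (Equivalence)
open import Relation.Binary.PropositionalEquality
open import Relation.Nullary using (Dec; yes; no; does; contradiction; ¬_)

private variable
  A B C : Set
  n r k w : ℕ

module _ where
  open import Data.Nat using (_+_; _*_; _^_; _≤_; _<_; _≤?_; z≤n; s≤s)
  open import Data.Nat.Properties

  -- Booleans, decisions and indicators.

  does⇒ : (P? : Dec A) → T (does P?) → A
  does⇒ (yes p) _ = p

  ⇒does : (P? : Dec A) → A → T (does P?)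
  ⇒does (yes _) _ = tt
  ⇒does (no ¬p) p = ¬p p

  ∧-intro : ∀ {a b} → T a → T b → T (a ∧ b)
  ∧-intro p q = Equivalence.from T-∧ (p , q)

  ∧-elimˡ : ∀ a {b} → T (a ∧ b) → T a
  ∧-elimˡ _ = proj₁ ∘ Equivalence.to T-∧

  ∧-elimʳ : ∀ a {b} → T (a ∧ b) → T b
  ∧-elimʳ _ = proj₂ ∘ Equivalence.to T-∧

  𝟙 : Bool → ℕ
  𝟙 true  = 1
  𝟙 false = 0

  𝟙-mono : ∀ {a b} → (T a → T b) → 𝟙 a ≤ 𝟙 b
  𝟙-mono {false}        _ = z≤n
  𝟙-mono {true} {true}  _ = ≤-refl
  𝟙-mono {true} {false} h with () ← h tt

  -- Sums over bit strings.

  -- Probabilities are kept unnormalised in `ℕ`: that of `f` is `∑ k (𝟙 ∘ f)` over `2 ^ k`.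
  ∑ : ∀ k → (Vec Bool k → ℕ) → ℕ
  ∑ zero    F = F []
  ∑ (suc k) F = ∑ k (F ∘ (false ∷_)) + ∑ k (F ∘ (true ∷_))

  ∑-mono : ∀ k {F G : Vec Bool k → ℕ} → (∀ x → F x ≤ G x) → ∑ k F ≤ ∑ k G
  ∑-mono zero    h = h []
  ∑-mono (suc k) h = +-mono-≤ (∑-mono k (h ∘ (false ∷_))) (∑-mono k (h ∘ (true ∷_)))

  ∑-cong : ∀ k {F G : Vec Bool k → ℕ} → (∀ x → F x ≡ G x) → ∑ k F ≡ ∑ k G
  ∑-cong zero    h = h []
  ∑-cong (suc k) h = cong₂ _+_ (∑-cong k (h ∘ (false ∷_))) (∑-cong k (h ∘ (true ∷_)))

  +-interchange : ∀ a b c d → (a + b) + (c + d) ≡ (a + c) + (b + d)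
  +-interchange = solve-∀

  ∑-+ : ∀ k (F G : Vec Bool k → ℕ) → ∑ k (λ x → F x + G x) ≡ ∑ k F + ∑ k G
  ∑-+ zero    F G = refl
  ∑-+ (suc k) F G
    rewrite ∑-+ k (F ∘ (false ∷_)) (G ∘ (false ∷_)) | ∑-+ k (F ∘ (true ∷_)) (G ∘ (true ∷_))
    = +-interchange (∑ k (F ∘ (false ∷_))) (∑ k (G ∘ (false ∷_))) _ _

  ∑-* : ∀ k c (F : Vec Bool k → ℕ) → ∑ k (λ x → c * F x) ≡ c * ∑ k F
  ∑-* zero    c F = refl
  ∑-* (suc k) c F = trans
    (cong₂ _+_ (∑-* k c (F ∘ (false ∷_))) (∑-* k c (F ∘ (true ∷_))))
    (sym (*-distribˡ-+ c (∑ k (F ∘ (false ∷_))) _))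

  double : ∀ a c → 2 * a * c ≡ a * c + a * c
  double = solve-∀

  ∑-const : ∀ k c → ∑ k (λ _ → c) ≡ 2 ^ k * c
  ∑-const zero    c = sym (+-identityʳ c)
  ∑-const (suc k) c rewrite ∑-const k c = sym (double (2 ^ k) c)

  ∑-≤-const : ∀ k c {F : Vec Bool k → ℕ} → (∀ x → F x ≤ c) → ∑ k F ≤ 2 ^ k * c
  ∑-≤-const k c h = ≤-trans (∑-mono k h) (≤-reflexive (∑-const k c))

  ∑-swap : ∀ r k (F : Vec Bool r → Vec Bool k → ℕ) →
           ∑ r (λ x → ∑ k (F x)) ≡ ∑ k (λ y → ∑ r (λ x → F x y))
  ∑-swap zero    k F = refl
  ∑-swap (suc r) k F = trans
    (cong₂ _+_ (∑-swap r k (F ∘ (false ∷_))) (∑-swap r k (F ∘ (true ∷_))))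
    (sym (∑-+ k (λ y → ∑ r (λ x → F (false ∷ x) y)) _))

  -- If both halves fell below their share `2 ^ k * c`, so would the whole; the search descends into
  -- a half that does not.
  ∑-average : ∀ k c (F : Vec Bool k → ℕ) → 2 ^ k * c ≤ ∑ k F → ∃ λ x → c ≤ F x
  ∑-average zero    c F h = [] , subst (_≤ F []) (+-identityʳ c) h
  ∑-average (suc k) c F h with 2 ^ k * c ≤? ∑ k (F ∘ (false ∷_)) | 2 ^ k * c ≤? ∑ k (F ∘ (true ∷_))
  ... | yes p | _     = let x , q = ∑-average k c _ p in false ∷ x , q
  ... | no _  | yes p = let x , q = ∑-average k c _ p in true ∷ x , q
  ... | no p  | no q  = contradiction (subst (_≤ ∑ (suc k) F) (double (2 ^ k) c) h)
                                      (<⇒≱ (+-mono-< (≰⇒> p) (≰⇒> q)))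

  -- Runs of permutation programs, forwards and backwards.

  Layer : ℕ → Set
  Layer w = Bool → Permutation′ w

  inv : Layer w → Layer w
  inv l b = flip (l b)

  run : Vec (Layer w) k → Fin w → Vec Bool k → Fin w
  run []       u []      = u
  run (l ∷ ls) u (b ∷ y) = run ls (l b ⟨$⟩ʳ u) y

  -- Prefixes are stored most recent layer (and bit) first.
  fwd : Vec (Layer w) r → Fin w → Vec Bool r → Fin w
  fwd []       v []      = v
  fwd (l ∷ ls) v (b ∷ x) = l b ⟨$⟩ʳ fwd ls v x

  -- Inverting the layers turns a prefix into a program that reads the most recent bit first, so
  -- facts about suffixes transfer to prefixes.
  fwd⇒run : ∀ (ls : Vec (Layer w) r) {v u} x → fwd ls v x ≡ u → run (map inv ls) u x ≡ v
  fwd⇒run []       []      refl = refl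
  fwd⇒run (l ∷ ls) (b ∷ x) refl = fwd⇒run ls x (sym (inverseˡ (l b)))

  run⇒fwd : ∀ (ls : Vec (Layer w) r) {v u} x → run (map inv ls) u x ≡ v → fwd ls v x ≡ u
  run⇒fwd []       []      refl = refl
  run⇒fwd (l ∷ ls) (b ∷ x) e    = trans (cong (l b ⟨$⟩ʳ_) (run⇒fwd ls x e)) (inverseʳ (l b))

  run⇒back : ∀ (ls : Vec (Layer w) k) {u v} y → run ls u y ≡ v → fwd (map inv ls) v y ≡ u
  run⇒back []       []      refl = refl
  run⇒back (l ∷ ls) (b ∷ y) e    = trans (cong (flip (l b) ⟨$⟩ʳ_) (run⇒back ls y e)) (inverseˡ (l b))

  -- Both states are recovered from `v` by undoing the bits of `y`: a suffix pins down a single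
  -- state.
  run-injective : ∀ (ls : Vec (Layer w) k) {u u′ v} y → run ls u y ≡ v → run ls u′ y ≡ v → u ≡ u′
  run-injective ls y e e′ = trans (sym (run⇒back ls y e)) (run⇒back ls y e′)

  eqFin⇒≡ : ∀ {u v : Fin w} → T (eqFin u v) → u ≡ v
  eqFin⇒≡ = does⇒ (_ Data.Fin.≟ _)

  ≡⇒eqFin : ∀ {u v : Fin w} → u ≡ v → T (eqFin u v)
  ≡⇒eqFin = ⇒does (_ Data.Fin.≟ _)

  runTo : Vec (Layer w) k → Fin w → Fin w → Vec Bool k → Bool
  runTo ls v u y = eqFin (run ls u y) v

  fwdTo : Vec (Layer w) r → Fin w → Fin w → Vec Bool r → Bool
  fwdTo ls v u x = eqFin (fwd ls v x) u

  -- Density, and the probability lost at sparse states.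

  -- Acceptance probability at least `1 / M`, with denominators cleared.
  dense : ℕ → ∀ {k} → BoolFun k → Bool
  dense M {k} f = does (2 ^ k ≤? M * ∑ k (𝟙 ∘ f))

  dense⇒≤ : ∀ M {k} (f : BoolFun k) → T (dense M f) → 2 ^ k ≤ M * ∑ k (𝟙 ∘ f)
  dense⇒≤ M f = does⇒ (_ ≤? _)

  ≤⇒dense : ∀ M {k} (f : BoolFun k) → 2 ^ k ≤ M * ∑ k (𝟙 ∘ f) → T (dense M f)
  ≤⇒dense M f = ⇒does (_ ≤? _)

  -- A dense `f` contributes nothing, and any other has probability below `1 / M`.
  sparse-≤ : ∀ M {k} (f : BoolFun k) → M * ∑ k (λ y → 𝟙 (f y ∧ not (dense M f))) ≤ 2 ^ k
  sparse-≤ M {k} f with dense M f in eq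
  ... | true = begin
      M * ∑ k (λ y → 𝟙 (f y ∧ false)) ≤⟨ *-monoʳ-≤ M (∑-≤-const k 0 (λ y → 𝟙-mono {f y ∧ false} {false} (∧-elimʳ (f y)))) ⟩
      M * (2 ^ k * 0)                 ≡⟨ cong (M *_) (*-zeroʳ (2 ^ k)) ⟩
      M * 0                           ≡⟨ *-zeroʳ M ⟩
      0                               ≤⟨ z≤n ⟩
      2 ^ k                           ∎ where open ≤-Reasoning
  ... | false = begin
      M * ∑ k (λ y → 𝟙 (f y ∧ true)) ≤⟨ *-monoʳ-≤ M (∑-mono k (λ y → 𝟙-mono {f y ∧ true} {f y} (∧-elimˡ (f y)))) ⟩
      M * ∑ k (𝟙 ∘ f)                ≤⟨ <⇒≤ (≰⇒> λ p → subst T eq (≤⇒dense M f p)) ⟩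
      2 ^ k                          ∎ where open ≤-Reasoning

  𝟙-not-∧ : ∀ a p q → 𝟙 (a ∧ not (p ∧ q)) ≤ 𝟙 (a ∧ not p) + 𝟙 (a ∧ not q)
  𝟙-not-∧ false _     _ = z≤n
  𝟙-not-∧ true  false _ = s≤s z≤n
  𝟙-not-∧ true  true  _ = ≤-refl

  module Loss {w : ℕ} (M : ℕ) (v acc : Fin w) where

    -- A certificate needs both halves: a hitting prefix that reaches `u` and a hitting suffix that
    -- accepts from `u`.
    live : Vec (Layer w) r → Vec (Layer w) k → Fin w → Bool
    live pre suf u = dense M (fwdTo pre v u) ∧ dense M (runTo suf acc u)

    allLive : Vec (Layer w) r → Vec (Layer w) k → Fin w → Vec Bool k → Bool
    allLive pre []        u []      = live pre [] u
    allLive pre (l ∷ suf) u (b ∷ y) = live pre (l ∷ suf) u ∧ allLive (l ∷ pre) suf (l b ⟨$⟩ʳ u) y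

    allLive⇒live : (pre : Vec (Layer w) r) (suf : Vec (Layer w) k) → ∀ {u} y →
                   T (allLive pre suf u y) → T (live pre suf u)
    allLive⇒live pre []        []      h = h
    allLive⇒live pre (l ∷ suf) (b ∷ y) h = ∧-elimˡ (live pre (l ∷ suf) _) h

    sparse-suffix : (pre : Vec (Layer w) r) (suf : Vec (Layer w) k) →
      M * ∑ r (λ x → ∑ k (λ y → 𝟙 (runTo suf acc (fwd pre v x) y ∧ not (dense M (runTo suf acc (fwd pre v x))))))
        ≤ 2 ^ r * 2 ^ k
    sparse-suffix {r} {k} pre suf = ≤-trans (≤-reflexive (sym (∑-* r M _)))
      (∑-≤-const r (2 ^ k) λ x → sparse-≤ M (runTo suf acc (fwd pre v x)))

    -- The sums are swapped: once `y` is fixed, acceptance forces `x` to reach the single state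
    -- `back y`, which is charged only if it is rarely reached.
    sparse-prefix : (pre : Vec (Layer w) r) (suf : Vec (Layer w) k) →
      M * ∑ r (λ x → ∑ k (λ y → 𝟙 (runTo suf acc (fwd pre v x) y ∧ not (dense M (fwdTo pre v (fwd pre v x))))))
        ≤ 2 ^ r * 2 ^ k
    sparse-prefix {r} {k} pre suf = begin
        M * ∑ r (λ x → ∑ k (λ y → F x y)) ≡⟨ cong (M *_) (∑-swap r k F) ⟩
        M * ∑ k (λ y → ∑ r (λ x → F x y)) ≡⟨ ∑-* k M _ ⟨
        ∑ k (λ y → M * ∑ r (λ x → F x y)) ≤⟨ ∑-≤-const k (2 ^ r) (λ y → ≤-trans
          (*-monoʳ-≤ M (∑-mono r (F≤ y))) (sparse-≤ M (fwdTo pre v (back y)))) ⟩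
        2 ^ k * 2 ^ r                     ≡⟨ *-comm (2 ^ k) (2 ^ r) ⟩
        2 ^ r * 2 ^ k                     ∎
      where
      open ≤-Reasoning
      F : Vec Bool r → Vec Bool k → ℕ
      F x y = 𝟙 (runTo suf acc (fwd pre v x) y ∧ not (dense M (fwdTo pre v (fwd pre v x))))
      back : Vec Bool k → Fin w
      back = fwd (map inv suf) acc
      F≤ : ∀ y x → F x y ≤ 𝟙 (fwdTo pre v (back y) x ∧ not (dense M (fwdTo pre v (back y))))
      F≤ y x = 𝟙-mono λ h → let a = runTo suf acc (fwd pre v x) y
                                e = sym (run⇒back suf y (eqFin⇒≡ (∧-elimˡ a h))) in
        ∧-intro (≡⇒eqFin e) (subst (λ u → T (not (dense M (fwdTo pre v u)))) e (∧-elimʳ a h))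

    lost : (pre : Vec (Layer w) r) (suf : Vec (Layer w) k) → Vec Bool r → Vec Bool k → ℕ
    lost pre suf x y = 𝟙 (runTo suf acc (fwd pre v x) y ∧ not (allLive pre suf (fwd pre v x) y))

    sparse-layer : (pre : Vec (Layer w) r) (suf : Vec (Layer w) k) →
      M * ∑ r (λ x → ∑ k (λ y →
          𝟙 (runTo suf acc (fwd pre v x) y ∧ not (dense M (fwdTo pre v (fwd pre v x))))
        + 𝟙 (runTo suf acc (fwd pre v x) y ∧ not (dense M (runTo suf acc (fwd pre v x))))))
        ≤ 2 * (2 ^ r * 2 ^ k)
    sparse-layer {r} {k} pre suf = begin
        M * ∑ r (λ x → ∑ k (λ y → F x y + G x y))
          ≡⟨ cong (M *_) (trans (∑-cong r (λ x → ∑-+ k (F x) (G x))) (∑-+ r _ _)) ⟩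
        M * (∑ r (λ x → ∑ k (F x)) + ∑ r (λ x → ∑ k (G x)))
          ≡⟨ *-distribˡ-+ M (∑ r (λ x → ∑ k (F x))) _ ⟩
        M * ∑ r (λ x → ∑ k (F x)) + M * ∑ r (λ x → ∑ k (G x))
          ≤⟨ +-mono-≤ (sparse-prefix pre suf) (sparse-suffix pre suf) ⟩
        2 ^ r * 2 ^ k + 2 ^ r * 2 ^ k
          ≡⟨ cong (2 ^ r * 2 ^ k +_) (+-identityʳ (2 ^ r * 2 ^ k)) ⟨
        2 * (2 ^ r * 2 ^ k) ∎
      where
      open ≤-Reasoning
      F G : Vec Bool r → Vec Bool k → ℕ
      F x y = 𝟙 (runTo suf acc (fwd pre v x) y ∧ not (dense M (fwdTo pre v (fwd pre v x))))
      G x y = 𝟙 (runTo suf acc (fwd pre v x) y ∧ not (dense M (runTo suf acc (fwd pre v x))))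

    -- Union bound over the `suc k` layers of states from the cut onwards, each costing at most
    -- `2 / M`. The induction moves the cut one layer to the right.
    loss-≤ : (pre : Vec (Layer w) r) (suf : Vec (Layer w) k) →
      M * ∑ r (λ x → ∑ k (lost pre suf x)) ≤ 2 * suc k * (2 ^ r * 2 ^ k)
    loss-≤ {r} pre [] = ≤-trans
      (*-monoʳ-≤ M (∑-mono r λ x → 𝟙-not-∧ (runTo [] acc (fwd pre v x) [])
        (dense M (fwdTo pre v (fwd pre v x))) (dense M (runTo [] acc (fwd pre v x)))))
      (sparse-layer pre [])
    loss-≤ {r} {suc k} pre (l ∷ suf) = begin
        M * ∑ r (λ x → ∑ (suc k) (lost pre (l ∷ suf) x))
          ≤⟨ *-monoʳ-≤ M (∑-mono r λ x → ∑-mono (suc k) (bound x)) ⟩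
        M * ∑ r (λ x → ∑ (suc k) (λ y → F x y + G x y))
          ≡⟨ cong (M *_) (trans (∑-cong r (λ x → ∑-+ (suc k) (F x) (G x))) (∑-+ r _ _)) ⟩
        M * (∑ r (λ x → ∑ (suc k) (F x)) + ∑ r (λ x → ∑ (suc k) (G x)))
          ≡⟨ *-distribˡ-+ M (∑ r (λ x → ∑ (suc k) (F x))) _ ⟩
        M * ∑ r (λ x → ∑ (suc k) (F x)) + M * ∑ r (λ x → ∑ (suc k) (G x))
          -- Summing over the first bit of `y` is summing over it as the newest bit of `x`, so the
          -- tail becomes the loss at cut `suc r`.
          ≡⟨ cong (λ s → M * ∑ r (λ x → ∑ (suc k) (F x)) + M * s) (∑-+ r _ _) ⟩
        M * ∑ r (λ x → ∑ (suc k) (F x)) + M * ∑ (suc r) (λ x → ∑ k (lost (l ∷ pre) suf x))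
          ≤⟨ +-mono-≤ (sparse-layer pre (l ∷ suf)) (loss-≤ (l ∷ pre) suf) ⟩
        2 * (2 ^ r * (2 * 2 ^ k)) + 2 * suc k * (2 * 2 ^ r * 2 ^ k)
          ≡⟨ arith (2 ^ r) (2 ^ k) k ⟩
        2 * suc (suc k) * (2 ^ r * (2 * 2 ^ k)) ∎
      where
      open ≤-Reasoning
      F G : Vec Bool r → Vec Bool (suc k) → ℕ
      F x y = 𝟙 (runTo (l ∷ suf) acc (fwd pre v x) y ∧ not (dense M (fwdTo pre v (fwd pre v x))))
            + 𝟙 (runTo (l ∷ suf) acc (fwd pre v x) y ∧ not (dense M (runTo (l ∷ suf) acc (fwd pre v x))))
      G x (b ∷ y) = lost (l ∷ pre) suf (b ∷ x) y
      bound : ∀ x y → lost pre (l ∷ suf) x y ≤ F x y + G x y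
      bound x (b ∷ y) = ≤-trans
          (𝟙-not-∧ a (live pre (l ∷ suf) (fwd pre v x)) (allLive (l ∷ pre) suf (fwd (l ∷ pre) v (b ∷ x)) y))
          (+-monoˡ-≤ (G x (b ∷ y)) (𝟙-not-∧ a (dense M (fwdTo pre v (fwd pre v x))) (dense M (runTo (l ∷ suf) acc (fwd pre v x)))))
        where a = runTo (l ∷ suf) acc (fwd pre v x) (b ∷ y)
      arith : ∀ a b k → 2 * (a * (2 * b)) + 2 * suc k * (2 * a * b) ≡ 2 * suc (suc k) * (a * (2 * b))
      arith = solve-∀

  -- Greedy hitting of a finite family of dense functions.

  Dense : ℕ → BoolFun k → Set
  Dense {k} M g = 2 ^ k ≤ M * ∑ k (𝟙 ∘ g)

  hits : Vec Bool k → List (BoolFun k) → ℕ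
  hits x []      = 0
  hits x (g ∷ L) = 𝟙 (g x) + hits x L

  unhit : Vec Bool k → List (BoolFun k) → List (BoolFun k)
  unhit x = filter (λ g → T? (not (g x)))

  unhit+hits : ∀ (x : Vec Bool k) L → length (unhit x L) + hits x L ≡ length L
  unhit+hits x []      = refl
  unhit+hits x (g ∷ L) with g x
  ... | true  = trans (+-suc (length (unhit x L)) _) (cong suc (unhit+hits x L))
  ... | false = cong suc (unhit+hits x L)

  hit⊎unhit : ∀ (x : Vec Bool k) {L g} → g ∈ L → T (g x) ⊎ g ∈ unhit x L
  hit⊎unhit x {g = g} g∈L with g x in eq
  ... | true  = inj₁ tt
  ... | false = inj₂ (∈-filter⁺ (λ g → T? (not (g x))) g∈L (subst (T ∘ not) (sym eq) tt))

  -- Double counting of pairs of a point and a member accepting it: scaled by `M`, each dense member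
  -- accounts for at least `2 ^ k`.
  ∑-hits : ∀ M {L : List (BoolFun k)} → All (Dense M) L → 2 ^ k * length L ≤ ∑ k (λ x → M * hits x L)
  ∑-hits {k} M [] = ≤-trans (≤-reflexive (*-zeroʳ (2 ^ k))) z≤n
  ∑-hits {k} M {g ∷ L} (d ∷ ds) = begin
      2 ^ k * suc (length L)                              ≡⟨ *-suc (2 ^ k) (length L) ⟩
      2 ^ k + 2 ^ k * length L                            ≤⟨ +-mono-≤ d (∑-hits M ds) ⟩
      M * ∑ k (𝟙 ∘ g) + ∑ k (λ x → M * hits x L)          ≡⟨ cong (_+ ∑ k (λ x → M * hits x L)) (∑-* k M (𝟙 ∘ g)) ⟨
      ∑ k (λ x → M * 𝟙 (g x)) + ∑ k (λ x → M * hits x L)  ≡⟨ ∑-+ k _ _ ⟨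
      ∑ k (λ x → M * 𝟙 (g x) + M * hits x L)              ≡⟨ ∑-cong k (λ x → *-distribˡ-+ M (𝟙 (g x)) (hits x L)) ⟨
      ∑ k (λ x → M * hits x (g ∷ L))                      ∎
    where open ≤-Reasoning

  popular-point : ∀ M {L : List (BoolFun k)} → All (Dense M) L → ∃ λ x → length L ≤ M * hits x L
  popular-point {k} M {L} ds = ∑-average k (length L) (λ x → M * hits x L) (∑-hits M ds)

  -- State of the greedy choice after at most `j` points. By `shrinks`, either at most half of `L`
  -- is left or at least `j` times `length L / (2 M)` members are gone.
  record Thinning {k} (M j : ℕ) (L : List (BoolFun k)) : Set where
    field
      points  : List (Vec Bool k)
      rest    : List (BoolFun k)
      size    : length points ≤ j
      isDense : All (Dense M) rest
      covers  : ∀ {g} → g ∈ L → Any (T ∘ g) points ⊎ g ∈ rest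
      shrinks : 2 * length rest ≤ length L ⊎ 2 * M * length rest + j * length L ≤ 2 * M * length L

  thin : ∀ M j {L : List (BoolFun k)} → All (Dense M) L → Thinning M j L
  thin M zero {L} ds = record
    { points = [] ; rest = L ; size = z≤n ; isDense = ds ; covers = inj₂
    ; shrinks = inj₂ (≤-reflexive (+-identityʳ (2 * M * length L))) }
  thin M (suc j) {L} ds with thin M j ds
  ... | record { points = H ; rest = L′ ; size = s ; isDense = ds′ ; covers = c ; shrinks = inj₁ p } =
    record { points = H ; rest = L′ ; size = m≤n⇒m≤1+n s ; isDense = ds′ ; covers = c ; shrinks = inj₁ p }
  ... | record { points = H ; rest = L′ ; size = s ; isDense = ds′ ; covers = c ; shrinks = inj₂ p }
    with 2 * length L′ ≤? length L
  ... | yes q =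
    record { points = H ; rest = L′ ; size = m≤n⇒m≤1+n s ; isDense = ds′ ; covers = c ; shrinks = inj₁ q }
  -- More than half of `L` is left, so a point hitting a `1 / M` fraction of `L′` removes at least
  -- `length L / (2 M)` members.
  ... | no q = record
    { points = x ∷ H ; rest = unhit x L′ ; size = s≤s s
    ; isDense = All.filter⁺ (λ g → T? (not (g x))) ds′
    ; covers = covers′
    ; shrinks = inj₂ shrinks′ }
    where
    x = proj₁ (popular-point M ds′)
    covers′ : ∀ {g} → g ∈ L → Any (T ∘ g) (x ∷ H) ⊎ g ∈ unhit x L′
    covers′ g∈L with c g∈L
    ... | inj₁ h = inj₁ (there h)
    ... | inj₂ g∈L′ with hit⊎unhit x g∈L′
    ...   | inj₁ h = inj₁ (here h)
    ...   | inj₂ u = inj₂ u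
    N = length L
    c″ = hits x L′
    l″ = length (unhit x L′)
    open ≤-Reasoning
    factor : ∀ M l c → 2 * M * l + 2 * (M * c) ≡ 2 * M * (l + c)
    factor = solve-∀
    shrinks′ : 2 * M * l″ + suc j * N ≤ 2 * M * N
    shrinks′ = begin
      2 * M * l″ + (N + j * N)          ≡⟨ +-assoc (2 * M * l″) N (j * N) ⟨
      2 * M * l″ + N + j * N            ≤⟨ +-monoˡ-≤ (j * N) (+-monoʳ-≤ (2 * M * l″) (<⇒≤ (≰⇒> q))) ⟩
      2 * M * l″ + 2 * length L′ + j * N ≤⟨ +-monoˡ-≤ (j * N) (+-monoʳ-≤ (2 * M * l″) (*-monoʳ-≤ 2 (proj₂ (popular-point M ds′)))) ⟩
      2 * M * l″ + 2 * (M * c″) + j * N ≡⟨ cong (_+ j * N) (factor M l″ c″) ⟩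
      2 * M * (l″ + c″) + j * N         ≡⟨ cong (λ n → 2 * M * n + j * N) (unhit+hits x L′) ⟩
      2 * M * length L′ + j * N         ≤⟨ p ⟩
      2 * M * N                         ∎

  -- At `j = M` the second alternative of `shrinks` also says that half of `L` is gone.
  halves : ∀ m {L : List (BoolFun k)} (t : Thinning (suc m) (suc m) L) → 2 * length (Thinning.rest t) ≤ length L
  halves m {L} t with Thinning.shrinks t
  ... | inj₁ p = p
  ... | inj₂ p = *-cancelˡ-≤ (suc m) (+-cancelʳ-≤ (suc m * length L) _ _ (begin
      suc m * (2 * l) + suc m * length L   ≡⟨ cong (_+ suc m * length L) (comm m l) ⟩
      2 * suc m * l + suc m * length L     ≤⟨ p ⟩
      2 * suc m * length L                 ≡⟨ double (suc m) (length L) ⟩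
      suc m * length L + suc m * length L  ∎))
    where
    open ≤-Reasoning
    l = length (Thinning.rest t)
    comm : ∀ m l → suc m * (2 * l) ≡ 2 * suc m * l
    comm = solve-∀

  -- suc m points, each hitting a 1/(suc m) fraction of what is left, halve the family.
  greedy : ∀ m t {L : List (BoolFun k)} → All (Dense (suc m)) L → length L < 2 ^ t →
           ∃ λ H → length H ≤ t * suc m × (∀ {g} → g ∈ L → Any (T ∘ g) H)
  greedy m zero    {[]} ds s = [] , z≤n , λ ()
  greedy m zero    {_ ∷ _} ds (s≤s ())
  greedy m (suc t) {L} ds s =
      points ++ H , ≤-trans (≤-reflexive (length-++ points)) (+-mono-≤ size s′) , cov
    where
    th = thin (suc m) (suc m) ds
    open Thinning th
    rec = greedy m t isDense (*-cancelˡ-< 2 _ _ (≤-<-trans (halves m th) s))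
    H = proj₁ rec
    s′ = proj₁ (proj₂ rec)
    cov : ∀ {g} → g ∈ L → Any (T ∘ g) (points ++ H)
    cov g∈L with covers g∈L
    ... | inj₁ h = ++⁺ˡ h
    ... | inj₂ r = ++⁺ʳ points (proj₂ (proj₂ rec) r)

  hitting-family : ∀ m t (L : List (BoolFun k)) → length L < 2 ^ t →
    ∃ λ H → length H ≤ t * suc m × (∀ {g} → g ∈ L → Dense (suc m) g → Any (T ∘ g) H)
  hitting-family {k} m t L s =
      let H , b , c = greedy m t (all-filter dense? L) (≤-<-trans (length-filter dense? L) s)
      in  H , b , λ g∈L d → c (∈-filter⁺ dense? g∈L d)
    where
    dense? : ∀ g → Dec (Dense (suc m) g)
    dense? g = 2 ^ k ≤? suc m * ∑ k (𝟙 ∘ g)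

  -- Narrow programs and their number.

  length-cartesianProductWith : ∀ (f : A → B → C) xs ys →
    length (cartesianProductWith f xs ys) ≡ length xs * length ys
  length-cartesianProductWith f []       ys = refl
  length-cartesianProductWith f (x ∷ xs) ys = trans (length-++ (List.map (f x) ys))
    (cong₂ _+_ (length-map (f x) ys) (length-cartesianProductWith f xs ys))

  length-allFin : ∀ n → length (allFin n) ≡ n
  length-allFin n = length-tabulate {n = n} (λ i → i)

  -- A map from `Fin m` to itself coded as a number, in the manner of `funToFin`, so that all maps
  -- can be listed and counted.
  Table : ℕ → Set
  Table m = Fin (m ^ m)

  consult : ∀ {m} → Table m × Table m → Bool → Fin m → Fin m
  consult (c₀ , c₁) b = finToFun (if b then c₁ else c₀)

  prepend : ∀ {m} → Table m × Table m → (Fin m → BoolFun k) → Fin m → BoolFun (suc k)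
  prepend c G j (b ∷ y) = G (consult c b j) y

  nonSink : ∀ {m} → Fin (suc m) → Bool
  nonSink zero    = false
  nonSink (suc _) = true

  -- A narrow program G is given by its states: G j y tells whether state j accepts y, and zero is a rejecting sink.
  narrow : ∀ m k → List (Fin (suc m) → BoolFun k)
  narrow m zero    = (λ j _ → nonSink j) ∷ []
  narrow m (suc k) = cartesianProductWith prepend
    (cartesianProduct (allFin (suc m ^ suc m)) (allFin (suc m ^ suc m))) (narrow m k)

  narrowFunctions : ∀ m k → List (BoolFun k)
  narrowFunctions m k = cartesianProductWith (λ j G → G j) (allFin (suc m)) (narrow m k)

  n<2^n : ∀ n → n < 2 ^ n
  n<2^n zero    = s≤s z≤n
  n<2^n (suc n) = begin-strict
      suc n           ≤⟨ n<2^n n ⟩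
      2 ^ n           <⟨ m<m+n (2 ^ n) (≤-trans (s≤s z≤n) (n<2^n n)) ⟩
      2 ^ n + 2 ^ n   ≡⟨ cong (2 ^ n +_) (+-identityʳ (2 ^ n)) ⟨
      2 * 2 ^ n       ∎
    where open ≤-Reasoning

  -- Bits describing `k` layers: two tables per layer, `m` entries per table and `m` bits per entry,
  -- by the crude `m < 2 ^ m`.
  narrowBits : ℕ → ℕ → ℕ
  narrowBits m k = k * (2 * (m * m))

  length-narrow : ∀ m k → length (narrow m k) ≤ 2 ^ narrowBits (suc m) k
  length-narrow m zero    = ≤-refl
  length-narrow m (suc k) = begin
      length (narrow m (suc k))
        ≡⟨ length-cartesianProductWith prepend (cartesianProduct all all) (narrow m k) ⟩
      length (cartesianProduct all all) * length (narrow m k)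
        ≡⟨ cong (_* length (narrow m k)) (trans (length-cartesianProductWith _,_ all all)
             (cong₂ _*_ (length-allFin tables) (length-allFin tables))) ⟩
      tables * tables * length (narrow m k)
        ≤⟨ *-mono-≤ (*-mono-≤ tables≤ tables≤) (length-narrow m k) ⟩
      2 ^ (μ * μ) * 2 ^ (μ * μ) * 2 ^ narrowBits μ k
        ≡⟨ cong (_* 2 ^ narrowBits μ k) (^-distribˡ-+-* 2 (μ * μ) (μ * μ)) ⟨
      2 ^ (μ * μ + μ * μ) * 2 ^ narrowBits μ k
        ≡⟨ ^-distribˡ-+-* 2 (μ * μ + μ * μ) (narrowBits μ k) ⟨
      2 ^ (μ * μ + μ * μ + narrowBits μ k)
        ≡⟨ cong (λ e → 2 ^ (μ * μ + e + narrowBits μ k)) (+-identityʳ (μ * μ)) ⟨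
      2 ^ narrowBits μ (suc k) ∎
    where
    open ≤-Reasoning
    μ = suc m
    tables = μ ^ μ
    all = allFin tables
    tables≤ : tables ≤ 2 ^ (μ * μ)
    tables≤ = ≤-trans (^-monoˡ-≤ μ (<⇒≤ (n<2^n μ))) (≤-reflexive (^-*-assoc 2 μ μ))

  -- The start state takes `suc m` further bits; one last bit makes the bound strict, as the greedy
  -- choice requires.
  length-narrowFunctions : ∀ m k → length (narrowFunctions m k) < 2 ^ suc (suc m + narrowBits (suc m) k)
  length-narrowFunctions m k = begin-strict
      length (narrowFunctions m k)
        ≡⟨ trans (length-cartesianProductWith (λ j G → G j) (allFin (suc m)) (narrow m k))
                 (cong (_* length (narrow m k)) (length-allFin (suc m))) ⟩
      suc m * length (narrow m k)                  ≤⟨ *-mono-≤ (<⇒≤ (n<2^n (suc m))) (length-narrow m k) ⟩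
      2 ^ suc m * 2 ^ narrowBits (suc m) k         ≡⟨ ^-distribˡ-+-* 2 (suc m) (narrowBits (suc m) k) ⟨
      2 ^ (suc m + narrowBits (suc m) k)           <⟨ ^-monoʳ-< 2 (s≤s (s≤s z≤n)) (n<1+n (suc m + narrowBits (suc m) k)) ⟩
      2 ^ suc (suc m + narrowBits (suc m) k)       ∎
    where open ≤-Reasoning

  -- Coding the live states of a layer.

  -- `enc` is injective on good states, where `dec` undoes it, and sends all others to the sink
  -- `zero`. A layer of any width thus fits into `suc m` codes.
  record Encoding {w} (m : ℕ) (good : Fin w → Set) : Set where
    field
      enc      : Fin w → Fin (suc m)
      dec      : Fin (suc m) → Maybe (Fin w)
      dec-sink : dec zero ≡ nothing
      dec-enc  : ∀ {u} → good u → dec (enc u) ≡ just u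
      enc-bad  : ∀ {u} → ¬ good u → enc u ≡ zero

  -- Frees code 1 for the head of the list and keeps the sink in place.
  shift : ∀ {m} → Fin (suc m) → Fin (suc (suc m))
  shift zero    = zero
  shift (suc i) = suc (suc i)

  encode : ∀ {w} m (us : List (Fin w)) → length us ≤ m → Encoding m (_∈ us)
  encode m [] _ = record
    { enc = λ _ → zero ; dec = λ _ → nothing ; dec-sink = refl ; dec-enc = λ () ; enc-bad = λ _ → refl }
  encode {w} (suc m) (v ∷ us) (s≤s s) = record
    { enc = enc′ ; dec = dec′ ; dec-sink = refl ; dec-enc = dec-enc′ ; enc-bad = enc-bad′ }
    where
    open Encoding (encode m us s)
    enc′ : Fin w → Fin (suc (suc m))
    enc′ u with u Data.Fin.≟ v
    ... | yes _ = suc zero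
    ... | no  _ = shift (enc u)
    dec′ : Fin (suc (suc m)) → Maybe (Fin w)
    dec′ zero          = nothing
    dec′ (suc zero)    = just v
    dec′ (suc (suc i)) = dec (suc i)
    dec-shift : ∀ i → dec′ (shift i) ≡ dec i
    dec-shift zero    = sym dec-sink
    dec-shift (suc i) = refl
    dec-enc′ : ∀ {u} → u ∈ v ∷ us → dec′ (enc′ u) ≡ just u
    dec-enc′ {u} p with u Data.Fin.≟ v
    ... | yes e = cong just (sym e)
    dec-enc′ (here e)  | no ne = contradiction e ne
    dec-enc′ (there p) | no _  = trans (dec-shift _) (dec-enc p)
    enc-bad′ : ∀ {u} → ¬ u ∈ v ∷ us → enc′ u ≡ zero
    enc-bad′ {u} p with u Data.Fin.≟ v
    ... | yes e = contradiction (here e) p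
    ... | no _  = cong shift (enc-bad (p ∘ there))

  -- Counting in duplicate-free lists.

  count : (A → Bool) → List A → ℕ
  count φ []       = 0
  count φ (x ∷ xs) = 𝟙 (φ x) + count φ xs

  count-none : ∀ (φ : A → Bool) {xs} → All (λ x → ¬ T (φ x)) xs → count φ xs ≡ 0
  count-none φ []                 = refl
  count-none φ {x ∷ _} (p ∷ ps) with φ x
  ... | true  = contradiction tt p
  ... | false = count-none φ ps

  count-≤1 : ∀ (φ : A → Bool) → (∀ {x y} → T (φ x) → T (φ y) → x ≡ y) → ∀ {xs} → Unique xs → count φ xs ≤ 1
  count-≤1 φ inj []                   = z≤n
  count-≤1 φ inj {x ∷ xs} (x∉ ∷ uniq) with φ x in eq
  ... | false = count-≤1 φ inj uniq
  ... | true  = ≤-reflexive (cong suc (count-none φ (All.map (λ x≢y Ty → x≢y (inj (subst T (sym eq) tt) Ty)) x∉)))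

  -- Trimming a program to its live states.

  module Trim (M : ℕ) where

    live : Vec (Layer w) k → Fin w → Fin w → Bool
    live ls v u = dense M (runTo ls v u)

    -- Liveness is measured in the untrimmed program, so `length-liveStates` bounds the width of
    -- what remains.
    trim : Vec (Layer w) k → Fin w → Fin w → BoolFun k
    trim []       v u []      = live [] v u
    trim (l ∷ ls) v u (b ∷ y) = live (l ∷ ls) v u ∧ trim ls v (l b ⟨$⟩ʳ u) y

    trim⇒run : ∀ (ls : Vec (Layer w) k) v u y → T (trim ls v u y) → run ls u y ≡ v
    trim⇒run []       v u [] h with eqFin u v in eq
    ... | true  = eqFin⇒≡ (subst T (sym eq) tt)
    -- At the final layer a state other than `v` has count 0, hence is not live.
    ... | false with () ← subst (1 ≤_) (*-zeroʳ M) (does⇒ (1 ≤? M * 0) h)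
    trim⇒run (l ∷ ls) v u (b ∷ y) h = trim⇒run ls v _ y (∧-elimʳ (live (l ∷ ls) v u) h)

    -- Each lost input is charged to the first dead state on its path.
    trim-loss : ∀ (ls : Vec (Layer w) k) v u →
      M * ∑ k (𝟙 ∘ runTo ls v u) ≤ M * ∑ k (𝟙 ∘ trim ls v u) + 2 ^ k
    trim-loss {k = k} ls v u with live ls v u in eq
    trim-loss {k = k} ls v u | false = ≤-trans
      (<⇒≤ (≰⇒> λ p → subst T eq (≤⇒dense M (runTo ls v u) p)))
      (m≤n+m (2 ^ k) (M * ∑ k (𝟙 ∘ trim ls v u)))
    trim-loss [] v u | true rewrite eq with eqFin u v
    ... | true  = m≤m+n (M * 1) 1
    ... | false = ≤-trans (≤-trans (≤-reflexive (*-zeroʳ M)) z≤n) (m≤m+n (M * 1) 1)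
    trim-loss {k = suc k} (l ∷ ls) v u | true rewrite eq = begin
        M * (R false + R true)          ≡⟨ *-distribˡ-+ M (R false) (R true) ⟩
        M * R false + M * R true        ≤⟨ +-mono-≤ (trim-loss ls v (l false ⟨$⟩ʳ u)) (trim-loss ls v (l true ⟨$⟩ʳ u)) ⟩
        (M * S false + 2 ^ k) + (M * S true + 2 ^ k) ≡⟨ arith M (S false) (S true) (2 ^ k) ⟩
        M * (S false + S true) + 2 * 2 ^ k ∎
      where
      open ≤-Reasoning
      R S : Bool → ℕ
      R b = ∑ k (𝟙 ∘ runTo ls v (l b ⟨$⟩ʳ u))
      S b = ∑ k (𝟙 ∘ trim ls v (l b ⟨$⟩ʳ u))
      arith : ∀ M a b c → (M * a + c) + (M * b + c) ≡ M * (a + b) + 2 * c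
      arith = solve-∀

    liveStates : Vec (Layer w) k → Fin w → List (Fin w)
    liveStates {w} ls v = filter (λ u → T? (live ls v u)) (allFin w)

    -- Every y leads to v from exactly one state, so the densities over all states add up to 1.
    length-liveStates : ∀ (ls : Vec (Layer w) k) v → length (liveStates ls v) ≤ M
    length-liveStates {w} {k} ls v = *-cancelʳ-≤ _ _ (2 ^ k) {{m^n≢0 2 k}} (begin
        length us * 2 ^ k                           ≤⟨ total us (all-filter (λ u → T? (live ls v u)) (allFin w)) ⟩
        M * ∑ k (λ y → count (λ u → runTo ls v u y) us)
          ≤⟨ *-monoʳ-≤ M (∑-≤-const k 1 λ y → count-≤1 (λ u → runTo ls v u y)
               (λ p q → run-injective ls y (eqFin⇒≡ p) (eqFin⇒≡ q))
               (Unique.filter⁺ (λ u → T? (live ls v u)) (allFin⁺ w))) ⟩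
        M * (2 ^ k * 1)                             ≡⟨ cong (M *_) (*-identityʳ (2 ^ k)) ⟩
        M * 2 ^ k                                   ∎)
      where
      open ≤-Reasoning
      us = liveStates ls v
      total : ∀ us → All (T ∘ live ls v) us → length us * 2 ^ k ≤ M * ∑ k (λ y → count (λ u → runTo ls v u y) us)
      total [] [] = z≤n
      total (u ∷ us) (p ∷ ps) = begin
        2 ^ k + length us * 2 ^ k
          ≤⟨ +-mono-≤ (dense⇒≤ M (runTo ls v u) p) (total us ps) ⟩
        M * ∑ k (𝟙 ∘ runTo ls v u) + M * ∑ k (λ y → count (λ u → runTo ls v u y) us)
          ≡⟨ *-distribˡ-+ M (∑ k (𝟙 ∘ runTo ls v u)) _ ⟨
        M * (∑ k (𝟙 ∘ runTo ls v u) + ∑ k (λ y → count (λ u → runTo ls v u y) us))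
          ≡⟨ cong (M *_) (∑-+ k _ _) ⟨
        M * ∑ k (λ y → 𝟙 (runTo ls v u y) + count (λ u → runTo ls v u y) us) ∎

    -- The type of `program` does not mention `w`: one finite list serves all widths. `sink` is
    -- carried for the induction, where a dead state has to reject every continuation.
    record Simulation (ls : Vec (Layer w) k) (v : Fin w) : Set where
      field
        code     : Fin w → Fin (suc M)
        program  : Fin (suc M) → BoolFun k
        isNarrow : program ∈ narrow M k
        simulates : ∀ u y → program (code u) y ≡ trim ls v u y
        sink     : ∀ y → program zero y ≡ false

    simulate : ∀ (ls : Vec (Layer w) k) v → Simulation ls v
    simulate {w} [] v = record
      { code = enc ; program = λ j _ → nonSink j ; isNarrow = here refl
      ; simulates = λ { u [] → sim u } ; sink = λ _ → refl }
      where
      live? = λ u → T? (live [] v u)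
      open Encoding (encode M (liveStates [] v) (length-liveStates [] v))
      sim : ∀ u → nonSink (enc u) ≡ live [] v u
      sim u with live [] v u in eq
      ... | false = cong nonSink (enc-bad λ p → subst T eq (proj₂ (∈-filter⁻ live? {xs = allFin w} p)))
      ... | true with enc u | dec-enc (∈-filter⁺ live? (∈-allFin u) (subst T (sym eq) tt))
      ...   | suc _ | _ = refl
      ...   | zero  | e with () ← trans (sym dec-sink) e
    simulate {w} {suc k} (l ∷ ls) v = record
      { code = enc ; program = prepend (tab false , tab true) program
      ; isNarrow = ∈-cartesianProductWith⁺ prepend
          (∈-cartesianProductWith⁺ _,_ (∈-allFin (tab false)) (∈-allFin (tab true))) isNarrow
      ; simulates = λ { u (b ∷ y) → sim u b y }
      ; sink = λ { (b ∷ y) → trans (cong (λ j → program j y) (trans (consult≡ b zero) (cong (maybe _ zero) dec-sink))) (sink y) } }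
      where
      open Simulation (simulate ls v)
      live? = λ u → T? (live (l ∷ ls) v u)
      open Encoding (encode M (liveStates (l ∷ ls) v) (length-liveStates (l ∷ ls) v))
      -- A code that decodes to nothing moves to the sink; a live state moves to the code of its
      -- successor, again the sink if that successor is dead.
      next : Bool → Fin (suc M) → Fin (suc M)
      next b j = maybe (λ u → code (l b ⟨$⟩ʳ u)) zero (dec j)
      tab : Bool → Table (suc M)
      tab b = funToFin (next b)
      consult≡ : ∀ b j → consult (tab false , tab true) b j ≡ next b j
      consult≡ false j = finToFun-funToFin (next false) j
      consult≡ true  j = finToFun-funToFin (next true) j
      sim : ∀ u b y → program (consult (tab false , tab true) b (enc u)) y ≡ live (l ∷ ls) v u ∧ trim ls v (l b ⟨$⟩ʳ u) y
      sim u b y rewrite consult≡ b (enc u) with live (l ∷ ls) v u in eq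
      ... | false rewrite enc-bad {u} (λ p → subst T eq (proj₂ (∈-filter⁻ live? {xs = allFin w} p)))
                        | dec-sink = sink y
      ... | true rewrite dec-enc (∈-filter⁺ live? (∈-allFin u) (subst T (sym eq) tt)) = simulates (l b ⟨$⟩ʳ u) y

  -- Hitting sets for permutation programs of any width.

  -- Liveness is tested at half the density `1 / K`. The number of halvings, the exponent of
  -- `length-narrowFunctions` at `m = 2 * K`, is multiplied by `2 * K` points per halving.
  hittingSize : ℕ → ℕ → ℕ
  hittingSize K k = suc (suc (2 * K) + narrowBits (suc (2 * K)) k) * (2 * K)

  -- Trimming at half the density costs at most half of the acceptance probability, so the narrow
  -- simulation stays dense and is hit; the original program accepts whatever the simulation
  -- accepts.
  hitting-set : ∀ K k → ∃ λ H → length H ≤ hittingSize (suc K) k ×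
    (∀ {w} (ls : Vec (Layer w) k) v u → Dense (suc K) (runTo ls v u) → ∃ λ x → x ∈ H × run ls u x ≡ v)
  hitting-set K k = H , proj₁ (proj₂ found) , λ ls v u d →
      let module S = Simulation (simulate ls v)
          x , x∈H , h = find (proj₂ (proj₂ found) (∈-cartesianProductWith⁺ (λ j G → G j) (∈-allFin (S.code u)) S.isNarrow) (dense-sim ls v u d))
      in  x , x∈H , trim⇒run ls v u x (subst T (S.simulates u x) h)
    where
    M = 2 * suc K
    open Trim M
    -- The first argument is the predecessor of `M`.
    found = hitting-family (K + suc (K + 0)) (suc (suc M + narrowBits (suc M) k)) (narrowFunctions M k) (length-narrowFunctions M k)
    H = proj₁ found
    dense-sim : ∀ {w} (ls : Vec (Layer w) k) v u → Dense (suc K) (runTo ls v u) →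
      Dense M (Simulation.program (simulate ls v) (Simulation.code (simulate ls v) u))
    dense-sim ls v u d = +-cancelʳ-≤ (2 ^ k) _ _ (begin
        2 ^ k + 2 ^ k                       ≡⟨ cong (2 ^ k +_) (+-identityʳ (2 ^ k)) ⟨
        2 * 2 ^ k                           ≤⟨ *-monoʳ-≤ 2 d ⟩
        2 * (suc K * ∑ k (𝟙 ∘ runTo ls v u)) ≡⟨ *-assoc 2 (suc K) _ ⟨
        M * ∑ k (𝟙 ∘ runTo ls v u)          ≤⟨ trim-loss ls v u ⟩
        M * ∑ k (𝟙 ∘ trim ls v u) + 2 ^ k   ≡⟨ cong (λ s → M * s + 2 ^ k) (∑-cong k (λ y → cong 𝟙 (Simulation.simulates (simulate ls v) u y))) ⟨
        M * ∑ k (𝟙 ∘ Simulation.program (simulate ls v) (Simulation.code (simulate ls v) u)) + 2 ^ k ∎)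
      where open ≤-Reasoning

  -- Splitting an input at a layer.

  infixl 6 _⊕_
  infixr 5 _▹_

  -- Addition for which r ⊕ suc k and suc r ⊕ k agree definitionally.
  _⊕_ : ℕ → ℕ → ℕ
  zero  ⊕ k = k
  suc r ⊕ k = r ⊕ suc k

  _▹_ : Vec A r → Vec A k → Vec A (r ⊕ k)
  []      ▹ y = y
  (a ∷ x) ▹ y = x ▹ (a ∷ y)

  run-▹ : ∀ (pre : Vec (Layer w) r) (suf : Vec (Layer w) k) v x y →
          run (pre ▹ suf) v (x ▹ y) ≡ run suf (fwd pre v x) y
  run-▹ []        suf v []      y = refl
  run-▹ (l ∷ pre) suf v (b ∷ x) y = run-▹ pre (l ∷ suf) v x (b ∷ y)

  T-any⁻ : ∀ (φ : A → Bool) xs → T (any φ xs) → ∃ λ x → x ∈ xs × T (φ x)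
  T-any⁻ φ xs h = find (any⁻ φ xs h)

  T-any⁺ : ∀ (φ : A → Bool) {xs x} → x ∈ xs → T (φ x) → T (any φ xs)
  T-any⁺ φ x∈xs h = any⁺ φ (lose x∈xs h)

  -- Certificates, their soundness and completeness.

  module Certificates (H : ∀ k → List (Vec Bool k)) where

    -- Invariant: the state reached before reading σ is the one from which y leads to acceptance.
    cert : ∀ r k → BoolFun (r ⊕ k) → Vec Bool k → Vec Bool k → Bool
    -- `y` is empty here, so the invariant already says that the state reached is the accept state.
    cert r zero    f y σ       = true
    cert r (suc k) f y (b ∷ σ) =
      any (λ x → any (λ y′ → f (x ▹ y) ∧ (f (x ▹ (b ∷ y′)) ∧ cert (suc r) k f y′ σ)) (H k)) (H r)

    -- `f y` says that the start state is the one pinned down by `y`, which establishes the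
    -- invariant of `cert`.
    certified : BoolFun n → BoolFun n
    certified {n} f σ = any (λ y → f y ∧ cert 0 n f y σ) (H n)

    suffixes : ∀ k → List (Vec Bool (suc k))
    suffixes k = H (suc k) ++ (List.map (false ∷_) (H k) ++ List.map (true ∷_) (H k))

    -- All strings that `cert` may ask about at the cuts from `r` onwards; at the last cut nothing
    -- is left to ask.
    probes : ∀ r k → List (Vec Bool (r ⊕ k))
    probes r zero    = []
    probes r (suc k) = cartesianProductWith _▹_ (H r) (suffixes k) ++ probes (suc r) k

    queries : ∀ n → List (Vec Bool n)
    queries n = H n ++ probes 0 n

    ∈-suffixes : ∀ b {y : Vec Bool k} → y ∈ H k → b ∷ y ∈ suffixes k
    ∈-suffixes {k} false y∈ = ∈-++⁺ʳ (H (suc k)) (∈-++⁺ˡ (∈-map⁺ (false ∷_) y∈))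
    ∈-suffixes {k} true  y∈ = ∈-++⁺ʳ (H (suc k)) (∈-++⁺ʳ (List.map (false ∷_) (H k)) (∈-map⁺ (true ∷_) y∈))

    -- Only positive answers enter a certificate, so it suffices that these are right; this suits a
    -- function known at the queries alone.
    cert-sound : ∀ (pre : Vec (Layer w) r) (suf : Vec (Layer w) k) {v acc f} →
      (∀ q → T (f q) → run (pre ▹ suf) v q ≡ acc) →
      ∀ {u} y σ → run suf u y ≡ acc → T (cert r k f y σ) → run suf u σ ≡ acc
    cert-sound pre [] sound [] [] e h = e
    cert-sound {r = r} {k = suc k} pre (l ∷ suf) {v} {acc} {f} sound {u} y (b ∷ σ) e h
      with x , _ , h₁ ← T-any⁻ _ (H r) h
      with y′ , _ , h₂ ← T-any⁻ _ (H k) h₁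
      with h₃ , h₄ ← ∧-elimˡ (f (x ▹ y)) h₂ , ∧-elimʳ (f (x ▹ y)) h₂
      with h₅ , h₆ ← ∧-elimˡ (f (x ▹ (b ∷ y′))) h₄ , ∧-elimʳ (f (x ▹ (b ∷ y′))) h₄ =
      cert-sound (l ∷ pre) suf {v} sound y′ σ
        (subst (λ s → run suf (l b ⟨$⟩ʳ s) y′ ≡ acc) x↦u
          (trans (sym (run-▹ pre (l ∷ suf) v x (b ∷ y′))) (sound _ h₅)))
        h₆
      where
      x↦u : fwd pre v x ≡ u
      -- `f (x ▹ y)` says that `y` accepts from the state reached by `x`; since `y` pins down one
      -- state, that state is `u`.
      x↦u = run-injective (l ∷ suf) y (trans (sym (run-▹ pre (l ∷ suf) v x y)) (sound _ h₃)) e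

    module _ (M : ℕ)
      (hit : ∀ {k w} (ls : Vec (Layer w) k) v u → Dense M (runTo ls v u) → ∃ λ x → x ∈ H k × run ls u x ≡ v)
      where

      -- The reversed prefix with inverted layers is itself a permutation program accepting the same
      -- strings, so the hitting set of length `r` serves prefixes too.
      hit-prefix : ∀ (pre : Vec (Layer w) r) v u → Dense M (fwdTo pre v u) → ∃ λ x → x ∈ H r × fwd pre v x ≡ u
      hit-prefix {r = r} pre v u d =
        let x , x∈ , e = hit (map inv pre) v u (≤-trans d (*-monoʳ-≤ M (∑-mono r λ x →
              𝟙-mono {fwdTo pre v u x} (λ h → ≡⇒eqFin (fwd⇒run pre x (eqFin⇒≡ h))))))
        in  x , x∈ , run⇒fwd pre x e

      module _ {w} {v acc : Fin w} where
        open Loss M v acc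

        hit-suffix : ∀ (pre : Vec (Layer w) r) (suf : Vec (Layer w) k) {u} σ →
          T (allLive pre suf u σ) → ∃ λ y → y ∈ H k × run suf u y ≡ acc
        hit-suffix pre suf {u} σ h = hit suf acc u (dense⇒≤ M (runTo suf acc u)
          (∧-elimʳ (dense M (fwdTo pre v u)) (allLive⇒live pre suf σ h)))

        -- Liveness of the current state supplies the prefix `x`, and liveness of the next one the
        -- suffix `y′`. Both strings asked about are probes of this cut, where `f` is known.
        cert-complete : ∀ (pre : Vec (Layer w) r) (suf : Vec (Layer w) k) {f} →
          (∀ {q} → q ∈ probes r k → run (pre ▹ suf) v q ≡ acc → T (f q)) →
          ∀ {u} y σ → y ∈ H k → run suf u y ≡ acc → T (allLive pre suf u σ) → T (cert r k f y σ)
        cert-complete pre [] compl y σ y∈ e h = tt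
        cert-complete {r = r} {k = suc k} pre (l ∷ suf) {f} compl {u} y (b ∷ σ) y∈ e h =
            T-any⁺ _ x∈ (T-any⁺ _ y′∈ (∧-intro accepts₁ (∧-intro accepts₂ (
              cert-complete (l ∷ pre) suf (compl ∘ ∈-++⁺ʳ (cartesianProductWith _▹_ (H r) (suffixes k))) y′ σ y′∈ e′ live′))))
          where
          live-u : T (live pre (l ∷ suf) u)
          live-u = allLive⇒live pre (l ∷ suf) (b ∷ σ) h
          live′ : T (allLive (l ∷ pre) suf (l b ⟨$⟩ʳ u) σ)
          live′ = ∧-elimʳ (live pre (l ∷ suf) u) h
          prefix = hit-prefix pre v u (dense⇒≤ M (fwdTo pre v u) (∧-elimˡ (dense M (fwdTo pre v u)) live-u))
          suffix = hit-suffix (l ∷ pre) suf σ live′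
          x = proj₁ prefix
          x∈ = proj₁ (proj₂ prefix)
          x↦u : fwd pre v x ≡ u
          x↦u = proj₂ (proj₂ prefix)
          y′ = proj₁ suffix
          y′∈ = proj₁ (proj₂ suffix)
          e′ = proj₂ (proj₂ suffix)
          accepts : ∀ z → z ∈ suffixes k → run (l ∷ suf) u z ≡ acc → T (f (x ▹ z))
          accepts z z∈ ez = compl (∈-++⁺ˡ (∈-cartesianProductWith⁺ _▹_ x∈ z∈))
            (trans (run-▹ pre (l ∷ suf) v x z) (trans (cong (λ s → run (l ∷ suf) s z) x↦u) ez))
          accepts₁ : T (f (x ▹ y))
          accepts₁ = accepts y (∈-++⁺ˡ y∈) e
          accepts₂ : T (f (x ▹ (b ∷ y′)))
          accepts₂ = accepts (b ∷ y′) (∈-suffixes b y′∈) e′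

  -- Reading a function off the answers.

  -- The default `false` off the queries can only lose certified inputs, never certify a rejected
  -- one.
  answer : List (Vec Bool n) → List Bool → BoolFun n
  answer (q ∷ qs) (a ∷ as) x = if does (≡-dec _≟B_ q x) then a else answer qs as x
  answer _        _        x = false

  answer-sound : ∀ qs (f : BoolFun n) x → T (answer qs (List.map f qs) x) → T (f x)
  answer-sound (q ∷ qs) f x h with ≡-dec _≟B_ q x
  ... | yes refl = h
  ... | no _     = answer-sound qs f x h

  answer-complete : ∀ {qs} (f : BoolFun n) {x} → x ∈ qs → T (f x) → T (answer qs (List.map f qs) x)
  answer-complete {qs = q ∷ qs} f {x} x∈ h with ≡-dec _≟B_ q x
  answer-complete f x∈         h | yes refl = h
  answer-complete f (here e)   h | no q≢x   = contradiction (sym e) q≢x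
  answer-complete f (there x∈) h | no _     = answer-complete f x∈ h

  -- Counting accepted inputs.

  length-filter-map : ∀ (f : B → Bool) (g : A → B) xs →
    length (filter (λ x → f x ≟B true) (List.map g xs)) ≡ length (filter (λ x → f (g x) ≟B true) xs)
  length-filter-map f g []       = refl
  length-filter-map f g (x ∷ xs) with f (g x)
  ... | true  = cong suc (length-filter-map f g xs)
  ... | false = length-filter-map f g xs

  countOnes≡∑ : ∀ (f : BoolFun n) → countOnes f ≡ ∑ n (𝟙 ∘ f)
  countOnes≡∑ {zero} f with f []
  ... | true  = refl
  ... | false = refl
  countOnes≡∑ {suc n} f = begin
      length (filter f? (List.map (false ∷_) xs ++ List.map (true ∷_) xs))
        ≡⟨ cong length (filter-++ f? (List.map (false ∷_) xs) _) ⟩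
      length (filter f? (List.map (false ∷_) xs) ++ filter f? (List.map (true ∷_) xs))
        ≡⟨ length-++ (filter f? (List.map (false ∷_) xs)) ⟩
      length (filter f? (List.map (false ∷_) xs)) + length (filter f? (List.map (true ∷_) xs))
        ≡⟨ cong₂ _+_ (length-filter-map f (false ∷_) xs) (length-filter-map f (true ∷_) xs) ⟩
      countOnes (f ∘ (false ∷_)) + countOnes (f ∘ (true ∷_))
        ≡⟨ cong₂ _+_ (countOnes≡∑ (f ∘ (false ∷_))) (countOnes≡∑ (f ∘ (true ∷_))) ⟩
      ∑ (suc n) (𝟙 ∘ f) ∎
    where
    open ≡-Reasoning
    xs = allInputs n
    f? = λ x → f x ≟B true

  runFrom≡run : ∀ (t : Fin n → Bool → Permutation′ w) v σ → runFrom t v σ ≡ run (tabulate t) v σ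
  runFrom≡run t v []      = refl
  runFrom≡run t v (b ∷ σ) = runFrom≡run (t ∘ suc) (t zero b ⟨$⟩ʳ v) σ

  -- The sampler, its error and its number of queries.

  module Sampler (H : ∀ k → List (Vec Bool k)) where
    open Certificates H

    estimate : ∀ n → List Bool → BoolFun n
    estimate n as = certified (answer (queries n) as)

    sampler : ∀ n → NonadaptiveAlg n
    sampler n = record { queries = queries n ; output = prob ∘ estimate n }

    module _ (B : PermBP n w) (f : BoolFun n) (f≡B : ∀ σ → f σ ≡ evalBP B σ) where
      open PermBP B renaming (trans to transition)
      layers : Vec (Layer w) n
      layers = tabulate transition

      f̂ : BoolFun n
      f̂ = answer (queries n) (List.map f (queries n))

      f⇒run : ∀ {σ} → T (f σ) → run layers start σ ≡ accept
      f⇒run {σ} h = trans (sym (runFrom≡run transition start σ)) (eqFin⇒≡ (subst T (f≡B σ) h))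

      run⇒f : ∀ {σ} → run layers start σ ≡ accept → T (f σ)
      run⇒f {σ} e = subst T (sym (f≡B σ)) (≡⇒eqFin (trans (runFrom≡run transition start σ) e))

      estimate-sound : ∀ σ → T (certified f̂ σ) → T (f σ)
      estimate-sound σ h with y , _ , h′ ← T-any⁻ _ (H n) h =
        run⇒f (cert-sound [] layers {start} (λ q → f⇒run ∘ answer-sound (queries n) f q) y σ
          (f⇒run (answer-sound (queries n) f y (∧-elimˡ (f̂ y) h′))) (∧-elimʳ (f̂ y) h′))

      module _ (M : ℕ)
        (hit : ∀ {k w} (ls : Vec (Layer w) k) v u → Dense M (runTo ls v u) → ∃ λ x → x ∈ H k × run ls u x ≡ v)
        where
        open Loss M start accept

        estimate-complete : ∀ σ → T (allLive [] layers start σ) → T (certified f̂ σ)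
        estimate-complete σ h with y , y∈ , e ← hit-suffix M hit [] layers σ h =
          T-any⁺ _ y∈ (∧-intro (answer-complete f (∈-++⁺ˡ y∈) (run⇒f e))
            (cert-complete M hit [] layers (λ q∈ → answer-complete f (∈-++⁺ʳ (H n) q∈) ∘ run⇒f) y σ y∈ e h))

        -- An accepted input is certified or lost. With the cut at the start, `loss-≤` bounds the
        -- lost ones by a `2 (n + 1) / M` fraction.
        estimate-loss : M * ∑ n (𝟙 ∘ f) ≤ M * ∑ n (𝟙 ∘ certified f̂) + 2 * suc n * 2 ^ n
        estimate-loss = begin
            M * ∑ n (𝟙 ∘ f)
              ≤⟨ *-monoʳ-≤ M (∑-mono n pointwise) ⟩
            M * ∑ n (λ σ → 𝟙 (certified f̂ σ) + lost [] layers [] σ)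
              ≡⟨ cong (M *_) (∑-+ n (𝟙 ∘ certified f̂) (lost [] layers [])) ⟩
            M * (∑ n (𝟙 ∘ certified f̂) + ∑ n (lost [] layers []))
              ≡⟨ *-distribˡ-+ M (∑ n (𝟙 ∘ certified f̂)) _ ⟩
            M * ∑ n (𝟙 ∘ certified f̂) + M * ∑ n (lost [] layers [])
              ≤⟨ +-monoʳ-≤ (M * ∑ n (𝟙 ∘ certified f̂)) (loss-≤ [] layers) ⟩
            M * ∑ n (𝟙 ∘ certified f̂) + 2 * suc n * (1 * 2 ^ n)
              ≡⟨ cong (λ s → M * ∑ n (𝟙 ∘ certified f̂) + 2 * suc n * s) (*-identityˡ (2 ^ n)) ⟩
            M * ∑ n (𝟙 ∘ certified f̂) + 2 * suc n * 2 ^ n ∎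
          where
          open ≤-Reasoning hiding (start)
          pointwise : ∀ σ → 𝟙 (f σ) ≤ 𝟙 (certified f̂ σ) + lost [] layers [] σ
          pointwise σ with allLive [] layers start σ in eq
          ... | true  = ≤-trans (𝟙-mono {f σ} λ _ → estimate-complete σ (subst T (sym eq) tt)) (m≤m+n _ _)
          ... | false = ≤-trans (𝟙-mono {f σ} λ h → ∧-intro (≡⇒eqFin (f⇒run h)) tt) (m≤n+m _ _)

    module _ (S N : ℕ) (size : ∀ {k} → k ≤ N → length (H k) ≤ S) where

      -- At each of the `k` cuts at most `S` prefixes meet at most `3 * S` suffixes: a hitting set
      -- for the remaining length, and the next shorter one behind either bit.
      length-probes : ∀ r k → r + k ≤ N → length (probes r k) ≤ k * (S * (3 * S))
      length-probes r zero    _ = z≤n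
      length-probes r (suc k) b = begin
          length (probes r (suc k))
            ≡⟨ length-++ (cartesianProductWith _▹_ (H r) (suffixes k)) ⟩
          length (cartesianProductWith _▹_ (H r) (suffixes k)) + length (probes (suc r) k)
            ≡⟨ cong (_+ length (probes (suc r) k)) (length-cartesianProductWith _▹_ (H r) (suffixes k)) ⟩
          length (H r) * length (suffixes k) + length (probes (suc r) k)
            ≤⟨ +-mono-≤ (*-mono-≤ (size (≤-trans (m≤m+n r (suc k)) b)) suffixes≤)
                        (length-probes (suc r) k (subst (_≤ N) (+-suc r k) b)) ⟩
          S * (3 * S) + k * (S * (3 * S)) ∎
        where
        open ≤-Reasoning
        1+k≤N : suc k ≤ N
        1+k≤N = ≤-trans (m≤n+m (suc k) r) b
        H≤ : ∀ c → length (List.map {B = Vec Bool (suc k)} (c ∷_) (H k)) ≤ S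
        H≤ c = ≤-trans (≤-reflexive (length-map (c ∷_) (H k))) (size (≤-trans (n≤1+n k) 1+k≤N))
        suffixes≤ : length (suffixes k) ≤ 3 * S
        suffixes≤ = begin
          length (suffixes k)
            ≡⟨ trans (length-++ (H (suc k))) (cong (length (H (suc k)) +_) (length-++ (List.map (false ∷_) (H k)))) ⟩
          length (H (suc k)) + (length (List.map (false ∷_) (H k)) + length (List.map (true ∷_) (H k)))
            ≤⟨ +-mono-≤ (size 1+k≤N) (+-mono-≤ (H≤ false) (≤-trans (H≤ true) (m≤m+n S 0))) ⟩
          3 * S ∎

      length-queries : length (queries N) ≤ S + N * (S * (3 * S))
      length-queries = ≤-trans (≤-reflexive (length-++ (H N))) (+-mono-≤ (size ≤-refl) (length-probes 0 N ≤-refl))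

  -- The chosen hitting sets and the resulting query count.

  -- Length 0 gets a single point by hand: for `n = 0` the query bound must not depend on `ε`,
  -- whereas `hittingSize` grows with `K`.
  hittingSets : ℕ → ∀ k → List (Vec Bool k)
  hittingSets K zero    = [] ∷ []
  hittingSets K (suc k) = proj₁ (hitting-set K (suc k))

  hittingSets-hit : ∀ K {k w} (ls : Vec (Layer w) k) v u → Dense (suc K) (runTo ls v u) →
                    ∃ λ x → x ∈ hittingSets K k × run ls u x ≡ v
  hittingSets-hit K {zero} [] v u d with eqFin u v in eq
  ... | true  = [] , here refl , eqFin⇒≡ (subst T (sym eq) tt)
  ... | false with () ← subst (1 ≤_) (*-zeroʳ (suc K)) d
  hittingSets-hit K {suc k} ls v u d = proj₂ (proj₂ (hitting-set K (suc k))) ls v u d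

  hittingSize-mono : ∀ {K K′ k k′} → K ≤ K′ → k ≤ k′ → hittingSize K k ≤ hittingSize K′ k′
  hittingSize-mono K≤ k≤ =
    *-mono-≤ (s≤s (+-mono-≤ M≤ (*-mono-≤ k≤ (*-monoʳ-≤ 2 (*-mono-≤ M≤ M≤))))) 2K≤
    where
    2K≤ = *-monoʳ-≤ 2 K≤
    M≤ = s≤s 2K≤

  length-hittingSets : ∀ K {k n} → k ≤ n → length (hittingSets K k) ≤ hittingSize (suc K) n
  length-hittingSets K {zero} {n} _ = *-mono-≤ {1} {suc (suc (2 * suc K) + narrowBits (suc (2 * suc K)) n)} (s≤s z≤n) (s≤s z≤n)
  length-hittingSets K {suc k} b = ≤-trans (proj₁ (proj₂ (hitting-set K (suc k)))) (hittingSize-mono (≤-refl {suc K}) b)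

  -- Each summand is raised to a multiple of `b ^ 3`, using `8 b + 1 ≤ 9 b`; the constant is
  -- `1376 = (1 + 9 + 2 * 9 * 9) * 8`.
  hittingSize-≤ : ∀ {b n} → 1 ≤ b → n ≤ b → hittingSize (4 * b) n ≤ 1376 * (b * b * b * b)
  hittingSize-≤ {b} {n} 1≤b n≤b = begin
      hittingSize (4 * b) n
        ≤⟨ hittingSize-mono (≤-refl {4 * b}) n≤b ⟩
      (1 + (suc (2 * (4 * b)) + b * (2 * (suc (2 * (4 * b)) * suc (2 * (4 * b)))))) * (2 * (4 * b))
        ≤⟨ *-monoˡ-≤ (2 * (4 * b)) (+-mono-≤ 1≤b³ (+-mono-≤ (≤-trans m≤9b (*-monoʳ-≤ 9 b≤b³)) (*-monoʳ-≤ b (*-monoʳ-≤ 2 (*-mono-≤ m≤9b m≤9b))))) ⟩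
      (b * b * b + (9 * (b * b * b) + b * (2 * (9 * b * (9 * b))))) * (2 * (4 * b))
        ≡⟨ arith b 9 ⟩
      1376 * (b * b * b * b) ∎
    where
    open ≤-Reasoning
    1≤b² : 1 ≤ b * b
    1≤b² = *-mono-≤ 1≤b 1≤b
    1≤b³ : 1 ≤ b * b * b
    1≤b³ = *-mono-≤ 1≤b² 1≤b
    b≤b³ : b ≤ b * b * b
    b≤b³ = ≤-trans (≤-reflexive (sym (*-identityˡ b))) (*-monoˡ-≤ b 1≤b²)
    nine : ∀ b → b + 2 * (4 * b) ≡ 9 * b
    nine = solve-∀
    m≤9b : suc (2 * (4 * b)) ≤ 9 * b
    m≤9b = ≤-trans (+-monoˡ-≤ (2 * (4 * b)) 1≤b) (≤-reflexive (nine b))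
    arith : ∀ b c → (b * b * b + (c * (b * b * b) + b * (2 * (c * b * (c * b))))) * (2 * (4 * b))
            ≡ (1 + (c + 2 * (c * c))) * (2 * 4) * (b * b * b * b)
    arith = solve-∀

  -- For positive `n`, `b = n (e + 1)` and hitting sets of at most `S = 1376 b ^ 4` points, there
  -- are at most `b * (S * S + 3 * S * S)` queries, which is `queryConstant * b ^ 9`.
  queryConstant : ℕ
  queryConstant = 4 * (1376 * 1376)

  -- suc (threshold n e) is definitionally 2 * suc n * suc e.
  threshold : ℕ → ℕ → ℕ
  threshold n e = e + (n + (suc n + 0)) * suc e

  length-sampler : ∀ n e → length (NonadaptiveAlg.queries (Sampler.sampler (hittingSets (threshold n e)) n))
                   ≤ 1 + queryConstant * (n * suc e) ^ 9
  -- The summand 1 is for this case, where the only query is the empty string.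
  length-sampler zero e = s≤s z≤n
  length-sampler n@(suc n-1) e = begin
      length (NonadaptiveAlg.queries (Sampler.sampler (hittingSets K) n))
        ≤⟨ Sampler.length-queries (hittingSets K) S n size ⟩
      S + n * (S * (3 * S))
        ≤⟨ +-mono-≤ S≤ (*-monoˡ-≤ (S * (3 * S)) n≤b) ⟩
      b * (S * S) + b * (S * (3 * S))
        ≡⟨ collect b S ⟩
      4 * (b * (S * S))
        ≡⟨ expand b 1376 ⟩
      queryConstant * b ^ 9
        ≤⟨ n≤1+n _ ⟩
      1 + queryConstant * b ^ 9 ∎
    where
    open ≤-Reasoning
    K = threshold n e
    b = n * suc e
    S = 1376 * (b * b * b * b)
    1≤b : 1 ≤ b
    1≤b = s≤s z≤n
    n≤b : n ≤ b
    n≤b = m≤m*n n (suc e)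
    quadruple : ∀ n e → 2 * (n + n) * e ≡ 4 * (n * e)
    quadruple = solve-∀
    -- `n + 1 ≤ 2 n`, as `n` is positive.
    M≤4b : suc K ≤ 4 * b
    M≤4b = ≤-trans (*-monoˡ-≤ (suc e) (*-monoʳ-≤ 2 (+-monoˡ-≤ n {1} {n} (s≤s z≤n)))) (≤-reflexive (quadruple n (suc e)))
    size : ∀ {k} → k ≤ n → length (hittingSets K k) ≤ S
    size k≤n = ≤-trans (length-hittingSets K k≤n) (≤-trans (hittingSize-mono M≤4b (≤-refl {n})) (hittingSize-≤ 1≤b n≤b))
    1≤S : 1 ≤ S
    1≤S = *-mono-≤ {1} {1376} (s≤s z≤n) (*-mono-≤ (*-mono-≤ (*-mono-≤ 1≤b 1≤b) 1≤b) 1≤b)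
    S≤ : S ≤ b * (S * S)
    S≤ = ≤-trans (≤-reflexive (sym (trans (*-identityˡ (1 * S)) (*-identityˡ S)))) (*-mono-≤ 1≤b (*-monoˡ-≤ S 1≤S))
    collect : ∀ b S → b * (S * S) + b * (S * (3 * S)) ≡ 4 * (b * (S * S))
    collect = solve-∀
    expand : ∀ b c → 4 * (b * (c * (b * b * b * b) * (c * (b * b * b * b))))
             ≡ 4 * (c * c) * (b * (b * (b * (b * (b * (b * (b * (b * (b * 1)))))))))
    expand = solve-∀

  -- Accuracy in terms of counts.

  module _ (n e : ℕ) where
    open Sampler (hittingSets (threshold n e))

    estimate-≤ : ∀ {f} → InPermBPClass n f →
      countOnes (estimate n (List.map f (NonadaptiveAlg.queries (sampler n)))) ≤ countOnes f
    estimate-≤ {f} (w , B , f≡B) = subst₂ _≤_ (sym (countOnes≡∑ g)) (sym (countOnes≡∑ f))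
      (∑-mono n λ σ → 𝟙-mono {g σ} (estimate-sound B f f≡B σ))
      where g = estimate n (List.map f (NonadaptiveAlg.queries (sampler n)))

    -- The factor `2 * suc n` of the threshold cancels against the loss over the `n + 1` layers,
    -- leaving an error of at most `1 / (e + 1)`.
    estimate-≥ : ∀ {f} → InPermBPClass n f →
      suc e * countOnes f ≤ suc e * countOnes (estimate n (List.map f (NonadaptiveAlg.queries (sampler n)))) + 2 ^ n
    estimate-≥ {f} (w , B , f≡B) =
      subst₂ (λ F G → suc e * F ≤ suc e * G + 2 ^ n) (sym (countOnes≡∑ f)) (sym (countOnes≡∑ g))
        (*-cancelˡ-≤ (2 * suc n) (begin
          2 * suc n * (suc e * ∑ n (𝟙 ∘ f))                       ≡⟨ *-assoc (2 * suc n) (suc e) (∑ n (𝟙 ∘ f)) ⟨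
          2 * suc n * suc e * ∑ n (𝟙 ∘ f)                         ≤⟨ estimate-loss B f f≡B (2 * suc n * suc e) (hittingSets-hit (threshold n e)) ⟩
          2 * suc n * suc e * ∑ n (𝟙 ∘ g) + 2 * suc n * 2 ^ n     ≡⟨ cong (_+ 2 * suc n * 2 ^ n) (*-assoc (2 * suc n) (suc e) (∑ n (𝟙 ∘ g))) ⟩
          2 * suc n * (suc e * ∑ n (𝟙 ∘ g)) + 2 * suc n * 2 ^ n   ≡⟨ *-distribˡ-+ (2 * suc n) (suc e * ∑ n (𝟙 ∘ g)) (2 ^ n) ⟨
          2 * suc n * (suc e * ∑ n (𝟙 ∘ g) + 2 ^ n)               ∎))
      where
      open ≤-Reasoning
      g = estimate n (List.map f (NonadaptiveAlg.queries (sampler n)))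

-- Rational arithmetic.

open import Data.Integer using (+_; +[1+_]; +≤+; +<+)
open import Data.Rational using (ℚ; mkℚ; 0ℚ; 1ℚ; _<_; _≤_; *<*; _+_; _*_; _-_; -_; _/_; _÷_; 1/_; ∣_∣; >-nonZero; toℚᵘ; NonNegative)
open import Data.Rational.Properties

toℚᵘ-/ : ∀ m d → toℚᵘ (+ m / suc d) ℚᵘ.≃ mkℚᵘ (+ m) d
toℚᵘ-/ m d = toℚᵘ-fromℚᵘ (mkℚᵘ (+ m) d)

/-mono-≤ : ∀ {a b} N .{{_ : ℕ.NonZero N}} → a ℕ.≤ b → + a / N ≤ + b / N
/-mono-≤ {a} {b} (suc N) a≤b = toℚᵘ-cancel-≤ (ℚᵘ.≤-respʳ-≃ (ℚᵘ.≃-sym (toℚᵘ-/ b N))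
  (ℚᵘ.≤-respˡ-≃ (ℚᵘ.≃-sym (toℚᵘ-/ a N)) (ℚᵘ.*≤* (ℤ.*-monoʳ-≤-nonNeg (+ suc N) (+≤+ a≤b)))))

/-≤-+ : ∀ F G N a d .{{_ : ℕ.NonZero N}} .(c : Coprime (suc a) (suc d)) → F ℕ.* suc d ℕ.≤ G ℕ.* suc d ℕ.+ suc a ℕ.* N →
        + F / N ≤ + G / N + mkℚ +[1+ a ] d c
/-≤-+ F G (suc N) a d c h = toℚᵘ-cancel-≤ (begin
    toℚᵘ (+ F / suc N)                          ≃⟨ toℚᵘ-/ F N ⟩
    mkℚᵘ (+ F) N                                ≤⟨ ℚᵘ.*≤* (subst₂ ℤ._≤_ lhs rhs (+≤+ (ℕ.*-monoˡ-≤ (suc N) h))) ⟩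
    mkℚᵘ (+ G) N ℚᵘ.+ mkℚᵘ +[1+ a ] d           ≃⟨ ℚᵘ.+-congˡ (toℚᵘ ε) (toℚᵘ-/ G N) ⟨
    toℚᵘ (+ G / suc N) ℚᵘ.+ toℚᵘ ε              ≃⟨ toℚᵘ-homo-+ (+ G / suc N) ε ⟨
    toℚᵘ (+ G / suc N + ε)                      ∎)
  where
  open ℚᵘ.≤-Reasoning
  ε = mkℚ +[1+ a ] d c
  lhs : + (F ℕ.* suc d ℕ.* suc N) ≡ + F ℤ.* + (suc N ℕ.* suc d)
  lhs = trans (cong +_ (arith F (suc d) (suc N))) (ℤ.pos-* F _)
    where
    arith : ∀ F d N → F ℕ.* d ℕ.* N ≡ F ℕ.* (N ℕ.* d)
    arith = solve-∀
  rhs : + ((G ℕ.* suc d ℕ.+ suc a ℕ.* suc N) ℕ.* suc N) ≡ (+ G ℤ.* + suc d ℤ.+ + suc a ℤ.* + suc N) ℤ.* + suc N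
  rhs = trans (ℤ.pos-* (G ℕ.* suc d ℕ.+ suc a ℕ.* suc N) (suc N)) (cong (ℤ._* + suc N)
    (trans (ℤ.pos-+ (G ℕ.* suc d) _) (cong₂ ℤ._+_ (ℤ.pos-* G (suc d)) (ℤ.pos-* (suc a) (suc N)))))

p≤q≤p+ε⇒∣p-q∣≤ε : ∀ {p q ε} → p ≤ q → q ≤ p + ε → ∣ p - q ∣ ≤ ε
p≤q≤p+ε⇒∣p-q∣≤ε {p} {q} {ε} p≤q q≤p+ε = begin
    ∣ p - q ∣      ≡⟨ ∣-p∣≡∣p∣ (p - q) ⟨
    ∣ - (p - q) ∣  ≡⟨ cong ∣_∣ (⁻¹-anti-homo-// +-0-group p q) ⟩
    ∣ q - p ∣      ≡⟨ 0≤p⇒∣p∣≡p (subst (_≤ q - p) (+-inverseʳ p) (+-monoˡ-≤ (- p) p≤q)) ⟩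
    q - p          ≤⟨ +-monoˡ-≤ (- p) q≤p+ε ⟩
    p + ε - p      ≡⟨ cong (_- p) (+-comm p ε) ⟩
    ε + p - p      ≡⟨ +-assoc ε p (- p) ⟩
    ε + (p - p)    ≡⟨ cong (λ s → ε + s) (+-inverseʳ p) ⟩
    ε + 0ℚ         ≡⟨ +-identityʳ ε ⟩
    ε              ∎
  where
  open ≤-Reasoning

ℕtoℚ-mono-≤ : ∀ {m n} → m ℕ.≤ n → ℕtoℚ m ≤ ℕtoℚ n
ℕtoℚ-mono-≤ = /-mono-≤ 1

ℕtoℚ-* : ∀ m n → ℕtoℚ (m ℕ.* n) ≡ ℕtoℚ m * ℕtoℚ n
ℕtoℚ-* m n = toℚᵘ-injective (begin-equality
    toℚᵘ (ℕtoℚ (m ℕ.* n))              ≃⟨ toℚᵘ-/ (m ℕ.* n) 0 ⟩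
    mkℚᵘ (+ (m ℕ.* n)) 0               ≡⟨ cong (λ i → mkℚᵘ i 0) (ℤ.pos-* m n) ⟩
    mkℚᵘ (+ m) 0 ℚᵘ.* mkℚᵘ (+ n) 0     ≃⟨ ℚᵘ.*-cong (toℚᵘ-/ m 0) (toℚᵘ-/ n 0) ⟨
    toℚᵘ (ℕtoℚ m) ℚᵘ.* toℚᵘ (ℕtoℚ n)   ≃⟨ toℚᵘ-homo-* (ℕtoℚ m) (ℕtoℚ n) ⟨
    toℚᵘ (ℕtoℚ m * ℕtoℚ n)             ∎)
  where open ℚᵘ.≤-Reasoning

ℕtoℚ-+ : ∀ m n → ℕtoℚ (m ℕ.+ n) ≡ ℕtoℚ m + ℕtoℚ n
ℕtoℚ-+ m n = toℚᵘ-injective (begin-equality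
    toℚᵘ (ℕtoℚ (m ℕ.+ n))              ≃⟨ toℚᵘ-/ (m ℕ.+ n) 0 ⟩
    mkℚᵘ (+ (m ℕ.+ n)) 0               ≡⟨ cong (λ i → mkℚᵘ i 0) (trans (ℤ.pos-+ m n) (sym (cong₂ ℤ._+_ (ℤ.*-identityʳ (+ m)) (ℤ.*-identityʳ (+ n))))) ⟩
    mkℚᵘ (+ m) 0 ℚᵘ.+ mkℚᵘ (+ n) 0     ≃⟨ ℚᵘ.+-cong (toℚᵘ-/ m 0) (toℚᵘ-/ n 0) ⟨
    toℚᵘ (ℕtoℚ m) ℚᵘ.+ toℚᵘ (ℕtoℚ n)   ≃⟨ toℚᵘ-homo-+ (ℕtoℚ m) (ℕtoℚ n) ⟨
    toℚᵘ (ℕtoℚ m + ℕtoℚ n)             ∎)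
  where open ℚᵘ.≤-Reasoning

ℕtoℚ-nonNeg : ∀ n → NonNegative (ℕtoℚ n)
ℕtoℚ-nonNeg n = normalize-nonNeg n 1

-- The rational on the right is `1 / ε` for `ε = (a + 1) / (d + 1)`, so numerator and denominator
-- trade places.
ℕtoℚ-≤ : ∀ e a d .(c : Coprime (suc d) (suc a)) → e ℕ.* suc a ℕ.≤ 2 ℕ.* suc d → ℕtoℚ e ≤ ℕtoℚ 2 * mkℚ +[1+ d ] a c
ℕtoℚ-≤ e a d c h = toℚᵘ-cancel-≤ (begin
    toℚᵘ (ℕtoℚ e)                        ≃⟨ toℚᵘ-/ e 0 ⟩
    mkℚᵘ (+ e) 0                         ≤⟨ ℚᵘ.*≤* (subst₂ ℤ._≤_ lhs rhs (+≤+ h)) ⟩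
    mkℚᵘ (+ 2) 0 ℚᵘ.* mkℚᵘ +[1+ d ] a    ≃⟨ toℚᵘ-homo-* (ℕtoℚ 2) (mkℚ +[1+ d ] a c) ⟨
    toℚᵘ (ℕtoℚ 2 * mkℚ +[1+ d ] a c)     ∎)
  where
  open ℚᵘ.≤-Reasoning
  lhs : + (e ℕ.* suc a) ≡ + e ℤ.* + (1 ℕ.* suc a)
  lhs = trans (cong (λ s → + (e ℕ.* s)) (sym (ℕ.*-identityˡ (suc a)))) (ℤ.pos-* e _)
  rhs : + (2 ℕ.* suc d) ≡ (+ 2 ℤ.* + suc d) ℤ.* + 1
  rhs = trans (ℤ.pos-* 2 (suc d)) (sym (ℤ.*-identityʳ _))

-- The query bound as a polynomial in `n / ε`.

monomial : ℕ → ℚ → Poly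
monomial zero    c = c ∷ []
monomial (suc j) c = 0ℚ ∷ monomial j c

-- Each factor `b` is traded for `2 * X`, the 2 going into the coefficient; the induction therefore
-- runs over all `c`.
≤-monomial : ∀ j c b X → .{{NonNegative X}} → ℕtoℚ b ≤ ℕtoℚ 2 * X →
  ℕtoℚ (c ℕ.* b ℕ.^ j) ≤ evalPoly (monomial j (ℕtoℚ (c ℕ.* 2 ℕ.^ j))) X
≤-monomial zero c b X _ = ≤-reflexive (sym (begin
    ℕtoℚ (c ℕ.* 1) + X * 0ℚ  ≡⟨ cong (λ s → ℕtoℚ (c ℕ.* 1) + s) (*-zeroʳ X) ⟩
    ℕtoℚ (c ℕ.* 1) + 0ℚ      ≡⟨ +-identityʳ _ ⟩
    ℕtoℚ (c ℕ.* 1)           ∎))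
  where open ≡-Reasoning
≤-monomial (suc j) c b X b≤2X = begin
    ℕtoℚ (c ℕ.* (b ℕ.* b ℕ.^ j))              ≡⟨ cong ℕtoℚ (swap c b (b ℕ.^ j)) ⟩
    ℕtoℚ (c ℕ.* b ℕ.^ j ℕ.* b)                ≡⟨ ℕtoℚ-* (c ℕ.* b ℕ.^ j) b ⟩
    ℕtoℚ (c ℕ.* b ℕ.^ j) * ℕtoℚ b             ≤⟨ *-monoˡ-≤-nonNeg (ℕtoℚ (c ℕ.* b ℕ.^ j)) {{ℕtoℚ-nonNeg (c ℕ.* b ℕ.^ j)}} b≤2X ⟩
    ℕtoℚ (c ℕ.* b ℕ.^ j) * (ℕtoℚ 2 * X)       ≡⟨ *-assoc (ℕtoℚ (c ℕ.* b ℕ.^ j)) (ℕtoℚ 2) X ⟨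
    ℕtoℚ (c ℕ.* b ℕ.^ j) * ℕtoℚ 2 * X         ≡⟨ cong (_* X) (ℕtoℚ-* (c ℕ.* b ℕ.^ j) 2) ⟨
    ℕtoℚ (c ℕ.* b ℕ.^ j ℕ.* 2) * X            ≡⟨ cong (λ s → ℕtoℚ s * X) (double′ c (b ℕ.^ j)) ⟩
    ℕtoℚ (2 ℕ.* c ℕ.* b ℕ.^ j) * X            ≤⟨ *-monoʳ-≤-nonNeg X (≤-monomial j (2 ℕ.* c) b X b≤2X) ⟩
    P * X                                     ≡⟨ *-comm P X ⟩
    X * P                                     ≡⟨ +-identityˡ (X * P) ⟨
    0ℚ + X * P                                ≡⟨ cong (λ s → 0ℚ + X * evalPoly (monomial j (ℕtoℚ s)) X) (double″ c (2 ℕ.^ j)) ⟩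
    0ℚ + X * evalPoly (monomial j (ℕtoℚ (c ℕ.* (2 ℕ.* 2 ℕ.^ j)))) X ∎
  where
  open ≤-Reasoning
  P = evalPoly (monomial j (ℕtoℚ (2 ℕ.* c ℕ.* 2 ℕ.^ j))) X
  swap : ∀ c b d → c ℕ.* (b ℕ.* d) ≡ c ℕ.* d ℕ.* b
  swap = solve-∀
  double′ : ∀ c d → c ℕ.* d ℕ.* 2 ≡ 2 ℕ.* c ℕ.* d
  double′ = solve-∀
  double″ : ∀ c d → 2 ℕ.* c ℕ.* d ≡ c ℕ.* (2 ℕ.* d)
  double″ = solve-∀

-- The polynomial `1 + 2 ^ 9 * queryConstant * X ^ 9`: consing the constant term shifts the tail of
-- degree 8 by one.
queryPoly : Poly
queryPoly = 1ℚ ∷ monomial 8 (ℕtoℚ (queryConstant ℕ.* 2 ℕ.^ 9))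

≤-queryPoly : ∀ b X → .{{NonNegative X}} → ℕtoℚ b ≤ ℕtoℚ 2 * X →
              ℕtoℚ (1 ℕ.+ queryConstant ℕ.* b ℕ.^ 9) ≤ evalPoly queryPoly X
≤-queryPoly b X b≤2X = begin
    ℕtoℚ (1 ℕ.+ queryConstant ℕ.* b ℕ.^ 9)  ≡⟨ ℕtoℚ-+ 1 (queryConstant ℕ.* b ℕ.^ 9) ⟩
    1ℚ + ℕtoℚ (queryConstant ℕ.* b ℕ.^ 9)   ≤⟨ +-monoʳ-≤ 1ℚ (≤-monomial 9 queryConstant b X b≤2X) ⟩
    1ℚ + (0ℚ + X * P)                       ≡⟨ cong (λ s → 1ℚ + s) (+-identityˡ (X * P)) ⟩
    evalPoly queryPoly X                    ∎
  where
  open ≤-Reasoning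
  P = evalPoly (monomial 8 (ℕtoℚ (queryConstant ℕ.* 2 ℕ.^ 9))) X

-- Parameters for a given `ε`.

theorem1p6 : Σ Poly λ p → (n : ℕ) → (ε : ℚ) → (0<ε : 0ℚ < ε) → ε < 1ℚ →
    Σ (NonadaptiveAlg n) λ A →
    IsSampler (InPermBPClass n) ε A ×
    ℕtoℚ (queryComplexity A) ≤ evalPoly p (_÷_ (ℕtoℚ n) ε {{>-nonZero 0<ε}})
theorem1p6 = queryPoly , construct
  where
  construct : (n : ℕ) → (ε : ℚ) → (0<ε : 0ℚ < ε) → ε < 1ℚ →
    Σ (NonadaptiveAlg n) λ A →
    IsSampler (InPermBPClass n) ε A ×
    ℕtoℚ (queryComplexity A) ≤ evalPoly queryPoly (_÷_ (ℕtoℚ n) ε {{>-nonZero 0<ε}})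
  construct n (mkℚ (+ zero) _ _) (*<* (+<+ ())) _
  construct n (mkℚ ℤ.-[1+ _ ] _ _) (*<* ()) _
  construct n ε@(mkℚ +[1+ a ] d c) 0<ε (*<* ε<1) = sampler n , isSampler , complexity
    where
    -- suc e is an integer between 1/ε and 2/ε.
    e = suc d ℕ./ suc a
    open Sampler (hittingSets (threshold n e))

    a≤d : suc a ℕ.≤ suc d
    a≤d = ℕ.<⇒≤ (ℤ.drop‿+<+ (subst₂ ℤ._<_ (ℤ.*-identityʳ +[1+ a ]) (ℤ.*-identityˡ +[1+ d ]) ε<1))

    1/ε≤ : suc d ℕ.≤ suc e ℕ.* suc a
    1/ε≤ = ℕ.≤-trans (ℕ.≤-reflexive (ℕ.m≡m%n+[m/n]*n (suc d) (suc a)))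
                     (ℕ.+-monoˡ-≤ (e ℕ.* suc a) (ℕ.m%n≤n (suc d) (suc a)))

    ≤2/ε : suc e ℕ.* suc a ℕ.≤ 2 ℕ.* suc d
    -- `ε < 1` pays for rounding up: the extra `suc a` is at most `suc d`.
    ≤2/ε = ℕ.+-mono-≤ a≤d (ℕ.≤-trans (ℕ.m/n*n≤m (suc d) (suc a)) (ℕ.m≤m+n (suc d) 0))

    isSampler : IsSampler (InPermBPClass n) ε (sampler n)
    isSampler f f∈ = p≤q≤p+ε⇒∣p-q∣≤ε
      (/-mono-≤ (2 ℕ.^ n) {{ℕ.m^n≢0 2 n}} (estimate-≤ n e f∈))
      -- Scaled by `suc e`, the claim follows from `estimate-≥`, because `1 / (e + 1) ≤ ε`.
      (/-≤-+ F G (2 ℕ.^ n) a d {{ℕ.m^n≢0 2 n}} c (ℕ.*-cancelˡ-≤ (suc e) (begin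
        suc e ℕ.* (F ℕ.* suc d)                              ≡⟨ ℕ.*-assoc (suc e) F (suc d) ⟨
        suc e ℕ.* F ℕ.* suc d                                ≤⟨ ℕ.*-monoˡ-≤ (suc d) (estimate-≥ n e f∈) ⟩
        (suc e ℕ.* G ℕ.+ 2 ℕ.^ n) ℕ.* suc d                  ≡⟨ expand (suc e) G (2 ℕ.^ n) (suc d) ⟩
        suc e ℕ.* (G ℕ.* suc d) ℕ.+ 2 ℕ.^ n ℕ.* suc d        ≤⟨ ℕ.+-monoʳ-≤ (suc e ℕ.* (G ℕ.* suc d)) (ℕ.*-monoʳ-≤ (2 ℕ.^ n) 1/ε≤) ⟩
        suc e ℕ.* (G ℕ.* suc d) ℕ.+ 2 ℕ.^ n ℕ.* (suc e ℕ.* suc a) ≡⟨ collect (suc e) (G ℕ.* suc d) (2 ℕ.^ n) (suc a) ⟩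
        suc e ℕ.* (G ℕ.* suc d ℕ.+ suc a ℕ.* 2 ℕ.^ n)        ∎)))
      where
      open ℕ.≤-Reasoning
      F = countOnes f
      G = countOnes (estimate n (List.map f (NonadaptiveAlg.queries (sampler n))))
      expand : ∀ e G N d → (e ℕ.* G ℕ.+ N) ℕ.* d ≡ e ℕ.* (G ℕ.* d) ℕ.+ N ℕ.* d
      expand = solve-∀
      collect : ∀ e H N a → e ℕ.* H ℕ.+ N ℕ.* (e ℕ.* a) ≡ e ℕ.* (H ℕ.+ a ℕ.* N)
      collect = solve-∀

    complexity : ℕtoℚ (queryComplexity (sampler n)) ≤ evalPoly queryPoly (ℕtoℚ n * 1/ ε)
    complexity = ≤-trans
      (ℕtoℚ-mono-≤ (ℕ.≤-trans (length-deduplicate (≡-dec _≟B_) (NonadaptiveAlg.queries (sampler n))) (length-sampler n e)))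
      (≤-queryPoly (n ℕ.* suc e) (ℕtoℚ n * 1/ ε) {{nonNeg*nonNeg⇒nonNeg (ℕtoℚ n) {{ℕtoℚ-nonNeg n}} (1/ ε)}} (begin
        ℕtoℚ (n ℕ.* suc e)           ≡⟨ ℕtoℚ-* n (suc e) ⟩
        ℕtoℚ n * ℕtoℚ (suc e)        ≤⟨ *-monoˡ-≤-nonNeg (ℕtoℚ n) {{ℕtoℚ-nonNeg n}} (ℕtoℚ-≤ (suc e) a d (Coprime.sym c) ≤2/ε) ⟩
        ℕtoℚ n * (ℕtoℚ 2 * 1/ ε)     ≡⟨ *-assoc (ℕtoℚ n) (ℕtoℚ 2) (1/ ε) ⟨
        ℕtoℚ n * ℕtoℚ 2 * 1/ ε       ≡⟨ cong (_* 1/ ε) (*-comm (ℕtoℚ n) (ℕtoℚ 2)) ⟩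
        ℕtoℚ 2 * ℕtoℚ n * 1/ ε       ≡⟨ *-assoc (ℕtoℚ 2) (ℕtoℚ n) (1/ ε) ⟩
        ℕtoℚ 2 * (ℕtoℚ n * 1/ ε)     ∎))
      where open ≤-Reasoning
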